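{- Every $(3,2)$-saturated subcubic graph $G$ such that $g_3(G)=3$ is $(1,1,3,3,3)$-packing colorable.
   Context: All graphs are finite, simple and undirected. For a non-decreasing sequence $S=(s_1,\dots,s_k)$ of positive integers, an $S$-packing coloring of $G$ is a partition of $V(G)$ into sets $V_1,\dots,V_k$ such that any two distinct vertices $u,v\in V_i$ satisfy $dist_G(u,v)>s_i$; $G$ is $S$-packing colorable if it admits one. $G$ is subcubic if its maximum degree is at most $3$. In a subcubic graph, a vertex of degree $3$ is heavy if all its neighbors have degree $3$. A subcubic graph is $(3,k)$-saturated ($0\le k\le 3$) if each heavy vertex is adjacent to at most $k$ heavy vertices. The local girth $g(v)$ of a vertex $v$ is the length of a shortest cycle containing $v$ ($\infty$ if none), and $g_3(G)=\max\{g(v): d_G(v)=3\}$. -}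

module Defs where

open import Data.Nat using (ℕ; zero; suc; _+_; _≤_; _<_)
open import Data.Bool using (Bool; true; false; if_then_else_)
open import Data.Fin using (Fin; zero; suc; inject₁; fromℕ)
open import Data.List using (List; map; allFin)
open import Data.Nat.ListAction using (sum)
open import Data.Vec using (Vec; lookup; _∷_; [])
open import Data.Product using (Σ; ∃; _×_; _,_)
open import Data.Empty using (⊥)
open import Relation.Nullary using (¬_)
open import Relation.Binary.PropositionalEquality using (_≡_; _≢_)
open import Function.Definitions using (Injective)

record Graph : Set where
  field
    n     : ℕ
    adj   : Fin n → Fin n → Bool
    sym   : ∀ u v → adj u v ≡ adj v u
    irr   : ∀ v → adj v v ≡ false

module _ (G : Graph) where
  open Graph G

  Adj : Fin n → Fin n → Set
  Adj u v = adj u v ≡ true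

  degree : Fin n → ℕ
  degree v = sum (map (λ u → if adj v u then 1 else 0) (allFin n))

  Subcubic : Set
  Subcubic = ∀ v → degree v ≤ 3

  Heavy : Fin n → Set
  Heavy v = degree v ≡ 3 × (∀ u → Adj v u → degree u ≡ 3)

  Saturated3 : ℕ → Set
  Saturated3 k = ∀ v → Heavy v → (f : Fin (suc k) → Fin n) →
    Injective _≡_ _≡_ f → (∀ i → Adj v (f i) × Heavy (f i)) → ⊥

  data Walk : Fin n → Fin n → ℕ → Set where
    here  : ∀ {u} → Walk u u zero
    step  : ∀ {u w v m} → Adj u w → Walk w v m → Walk u v (suc m)

  -- dist_G(u,v) > s  (also holds when u, v are in different components)
  DistGt : Fin n → Fin n → ℕ → Set
  DistGt u v s = ∀ m → m ≤ s → ¬ Walk u v m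

  CycleThrough : Fin n → ℕ → Set
  CycleThrough v zero = ⊥
  CycleThrough v (suc k) = 2 ≤ k × Σ (Fin (suc k) → Fin n) λ f →
    Injective _≡_ _≡_ f × f zero ≡ v ×
    (∀ (i : Fin k) → Adj (f (inject₁ i)) (f (suc i))) ×
    Adj (f (fromℕ k)) (f zero)

  LocalGirthIs : Fin n → ℕ → Set
  LocalGirthIs v ℓ = CycleThrough v ℓ × (∀ m → m < ℓ → ¬ CycleThrough v m)

  -- g_3(G) = ℓ (finite): the maximum of g(v) over degree-3 vertices is ℓ,
  -- i.e. it is attained, and every degree-3 vertex has finite g(v) ≤ ℓ
  G3Is : ℕ → Set
  G3Is ℓ = (∃ λ v → degree v ≡ 3 × LocalGirthIs v ℓ) ×
           (∀ v → degree v ≡ 3 → ∃ λ m → m ≤ ℓ × LocalGirthIs v m)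

  PackingColorable : ∀ {k} → Vec ℕ k → Set
  PackingColorable {k} S = Σ (Fin n → Fin k) λ c →
    ∀ u v → u ≢ v → c u ≡ c v → DistGt u v (lookup S (c u))

module Submission where

open import Defs
open import Data.Nat using (ℕ; zero; suc)
open import Data.Vec using (Vec; _∷_; [])
open import Data.Bool using (Bool; true; false; not; if_then_else_)
import Data.Bool as Bool
open import Data.Bool.Properties using (not-¬)
open import Data.Empty using (⊥; ⊥-elim)
open import Data.Fin using (Fin; zero; suc; toℕ; combine; punchIn; punchOut)
open import Data.Fin.Patterns using (0F; 1F; 2F; 3F)
import Data.Fin as Fin
open import Data.Fin.Properties
  using (_≟_; any?; all?; injective⇒≤; ¬∀⟶∃¬; punchIn-punchOut; punchOut-cong; punchOut-injective)
import Data.Fin.Properties as Fin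
open import Data.Fin.Subset using (Subset; ⁅_⁆; _∪_; _⊃_) renaming (_∈_ to _∈ˢ_; _∉_ to _∉ˢ_)
open import Data.Fin.Subset.Induction using (⊃-wellFounded; Acc; acc)
open import Data.Fin.Subset.Properties using (x∈⁅x⁆; x∈⁅y⁆⇒x≡y; p⊆p∪q; q⊆p∪q; x∈p∪q⁻)
  renaming (_∈?_ to _∈ˢ?_)
open import Data.List using (List; []; _∷_; allFin; length; lookup; map; filter)
import Data.List.Membership.DecPropositional as DecMembership
open import Data.List.Membership.Propositional using (_∈_)
open import Data.List.Membership.Propositional.Properties using (∈-allFin; ∈-filter⁺; ∈-filter⁻; ∈-lookup)
open import Data.List.Relation.Unary.All as All using (All; []; _∷_)
open import Data.List.Relation.Unary.AllPairs using ([]; _∷_)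
open import Data.List.Relation.Unary.Any using (here; there; index)
open import Data.List.Relation.Unary.Any.Properties using (lookup-index)
open import Data.List.Relation.Unary.Unique.Propositional using (Unique)
open import Data.List.Relation.Unary.Unique.Propositional.Properties using (allFin⁺; filter⁺)
import Data.Nat as ℕ
open import Data.Nat.ListAction using (sum)
import Data.Nat.Properties as ℕ
open import Data.Product using (Σ; ∃; ∃₂; ∃-syntax; _×_; _,_; proj₁; proj₂)
open import Data.Sum using (_⊎_; inj₁; inj₂; [_,_]′)
import Data.Vec as Vec
open import Function using (_∘_; Injective)
open import Relation.Binary using (tri<; tri≈; tri>)
open import Relation.Binary.PropositionalEquality using (_≡_; _≢_; refl; sym; trans; cong; subst; ≢-sym)
open import Relation.Nullary using (¬_; Dec; yes; no; contradiction; ¬?; _×-dec_; _⊎-dec_; _→-dec_)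

-- Every vertex of degree 3 lies on a triangle.  Picking one vertex of each triangle leaves a graph of maximum
-- degree 2; the picked vertices receive the three colours of radius 3, the rest the two colours of radius 1.
-- On the triangles the rest is a union of two matchings, hence bipartite.  Call an edge outer if it lies on no
-- triangle.  A triangle with a vertex of degree 2 is picked there.  By saturation, a triangle whose three outer
-- edges all lead to vertices of degree 3 is joined only to triangles with a vertex of degree 2.  In the remaining
-- triangles with three outer edges the pick avoids a vertex whose outer neighbour has degree at most 2, and a
-- 2-colouring decides between the other two so that picks are never adjacent.  A diamond is picked at a middle
-- vertex.  Two picks with outer edges that are at distance at most 3 are joined through the outer edge of one of
-- them, and each pick sees at most one other pick in this way: their conflicts form the graph of a function,
-- which is 3-colourable.  A pick without outer edge has at most two conflicts and is coloured afterwards.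
-- Finally the vertices off all triangles, of degree at most 2, are inserted one by one: if no Kempe exchange
-- makes a colour of radius 1 available, at most two vertices with a colour of radius 3 are within distance 3.

-- Vertices reachable from a given one

module Reachability {n} {E : Fin n → Fin n → Set} (E? : ∀ u v → Dec (E u v)) (x : Fin n) where

  Closed : (Fin n → Set) → Set
  Closed Q = ∀ {u v} → Q u → E u v → Q v

  LeastClosed : Subset n → Set₁
  LeastClosed P = x ∈ˢ P × Closed (_∈ˢ P) × (∀ (Q : Fin n → Set) → Q x → Closed Q → ∀ {u} → u ∈ˢ P → Q u)

  -- The head of any `E`-step leaving the set is adjoined, which must stop in a finite set.
  -- Minimality is carried along as an induction principle, so no path has to be stored.
  reach : ∃ LeastClosed
  reach = grow ⁅ x ⁆ (⊃-wellFounded ⁅ x ⁆) (x∈⁅x⁆ x)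
            (λ Q Qx _ u∈ → subst Q (sym (x∈⁅y⁆⇒x≡y x u∈)) Qx)
    where
    grow : ∀ P → Acc _⊃_ P → x ∈ˢ P → (∀ (Q : Fin n → Set) → Q x → Closed Q → ∀ {u} → u ∈ˢ P → Q u) → ∃ LeastClosed
    grow P (acc rec) x∈P least
      with any? (λ u → any? (λ v → (u ∈ˢ? P) ×-dec (E? u v) ×-dec ¬? (v ∈ˢ? P)))
    ... | no saturated = P , x∈P , closed , least
      where
      closed : Closed (_∈ˢ P)
      closed {u} {v} u∈P e with v ∈ˢ? P
      ... | yes v∈P = v∈P
      ... | no v∉P = contradiction (u , v , u∈P , e , v∉P) saturated
    ... | yes (u , v , u∈P , e , v∉P) =
      grow (P ∪ ⁅ v ⁆) (rec (p⊆p∪q ⁅ v ⁆ , v , q⊆p∪q P ⁅ v ⁆ (x∈⁅x⁆ v) , v∉P)) (p⊆p∪q ⁅ v ⁆ x∈P) least′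
      where
      least′ : ∀ (Q : Fin n → Set) → Q x → Closed Q → ∀ {w} → w ∈ˢ P ∪ ⁅ v ⁆ → Q w
      least′ Q Qx cl w∈ with x∈p∪q⁻ P ⁅ v ⁆ w∈
      ... | inj₁ w∈P = least Q Qx cl w∈P
      ... | inj₂ w∈v = subst Q (sym (x∈⁅y⁆⇒x≡y v w∈v)) (cl (least Q Qx cl u∈P) e)

-- Exchanging two colours on a set

not-injective : ∀ {a b} → not a ≡ not b → a ≡ b
not-injective {false} {false} _ = refl
not-injective {true}  {true}  _ = refl

module _ {n} {K : Fin n → Set} (K? : ∀ u → Dec (K u)) (κ : Fin n → Bool) where

  flip-on : Fin n → Bool
  flip-on u with K? u
  ... | yes _ = not (κ u)
  ... | no  _ = κ u

  flip-∈ : ∀ {u} → K u → flip-on u ≡ not (κ u)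
  flip-∈ {u} u∈ with K? u
  ... | yes _ = refl
  ... | no u∉ = contradiction u∈ u∉

  flip-∉ : ∀ {u} → ¬ K u → flip-on u ≡ κ u
  flip-∉ {u} u∉ with K? u
  ... | yes u∈ = contradiction u∈ u∉
  ... | no _ = refl

  flip-preserves-≢ : ∀ {u v} → (K u → K v) → (K v → K u) → κ u ≢ κ v → flip-on u ≢ flip-on v
  flip-preserves-≢ {u} {v} to from κ≢ with K? u | K? v
  ... | yes _  | yes _  = κ≢ ∘ not-injective
  ... | no _   | no _   = κ≢
  ... | yes u∈ | no v∉  = contradiction (to u∈) v∉
  ... | no u∉  | yes v∈ = contradiction (from v∈) u∉

≢-≢⇒≡ : ∀ {a b c : Bool} → a ≢ b → b ≢ c → a ≡ c
≢-≢⇒≡ {false} {false} a≢b _ = contradiction refl a≢b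
≢-≢⇒≡ {false} {true} {false} _ _ = refl
≢-≢⇒≡ {false} {true} {true} _ b≢c = contradiction refl b≢c
≢-≢⇒≡ {true} {true} a≢b _ = contradiction refl a≢b
≢-≢⇒≡ {true} {false} {true} _ _ = refl
≢-≢⇒≡ {true} {false} {false} _ b≢c = contradiction refl b≢c

-- The union of two matchings is bipartite

record IsMatching {n} (R : Fin n → Fin n → Set) : Set where
  field
    dec        : ∀ u v → Dec (R u v)
    symmetric  : ∀ {u v} → R u v → R v u
    irrefl     : ∀ {u} → ¬ R u u
    functional : ∀ {u v w} → R u v → R u w → v ≡ w

-- The edges of the second matching are added one by one; when an edge xy is monochromatic, x and y are
-- ends of two different alternating paths and the colours on the path of x are exchanged.
module TwoMatchings {n} {R₁ R₂ : Fin n → Fin n → Set} (m₁ : IsMatching R₁) (m₂ : IsMatching R₂) where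
  private
    module M₁ = IsMatching m₁
    module M₂ = IsMatching m₂
    open DecMembership (_≟_ {n}) using (_∈?_)

  -- The edges of the second matching treated so far. One end in the list suffices, since treating a
  -- vertex settles the only edge at it.
  Done : List (Fin n) → Fin n → Fin n → Set
  Done xs u v = R₂ u v × (u ∈ xs ⊎ v ∈ xs)

  done? : ∀ xs u v → Dec (Done xs u v)
  done? xs u v = M₂.dec u v ×-dec ((u ∈? xs) ⊎-dec (v ∈? xs))

  Done-sym : ∀ {xs u v} → Done xs u v → Done xs v u
  Done-sym (r , inj₁ u∈) = M₂.symmetric r , inj₂ u∈
  Done-sym (r , inj₂ v∈) = M₂.symmetric r , inj₁ v∈

  Proper : List (Fin n) → (Fin n → Bool) → Set
  Proper xs κ = (∀ {u v} → R₁ u v → κ u ≢ κ v) × (∀ {u v} → Done xs u v → κ u ≢ κ v)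

  initial : ∃ (Proper [])
  initial = κ , proper₁ , λ { (_ , inj₁ ()) ; (_ , inj₂ ()) }
    where
    κ : Fin n → Bool
    κ u with any? (λ v → M₁.dec u v ×-dec (u Fin.<? v))
    ... | yes _ = true
    ... | no  _ = false
    proper₁ : ∀ {u v} → R₁ u v → κ u ≢ κ v
    proper₁ {u} {v} r eq with any? (λ w → M₁.dec u w ×-dec (u Fin.<? w)) | any? (λ w → M₁.dec v w ×-dec (v Fin.<? w))
    proper₁ {u} {v} r eq | yes (w , r′ , u<w) | yes (t , r″ , v<t)
      with refl ← M₁.functional r r′ | refl ← M₁.functional (M₁.symmetric r) r″ = Fin.<-asym u<w v<t
    proper₁ {u} {v} r eq | no ¬p | no ¬q with Fin.<-cmp u v
    ... | tri< u<v _ _ = ¬p (v , r , u<v)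
    ... | tri≈ _ refl _ = M₁.irrefl r
    ... | tri> _ _ v<u = ¬q (u , M₁.symmetric r , v<u)
    proper₁ r () | yes _ | no _
    proper₁ r () | no _ | yes _

  module Exchange {x y xs κ} (xy : R₂ x y) (proper : Proper xs κ) (mono : κ x ≡ κ y) where

    E : Fin n → Fin n → Set
    E u v = R₁ u v ⊎ Done xs u v

    E-sym : ∀ {u v} → E u v → E v u
    E-sym (inj₁ r) = inj₁ (M₁.symmetric r)
    E-sym (inj₂ d) = inj₂ (Done-sym d)

    ¬xy-done : ¬ (x ∈ xs ⊎ y ∈ xs)
    ¬xy-done d = proj₂ proper (xy , d) mono

    open Reachability {E = E} (λ u v → M₁.dec u v ⊎-dec done? xs u v) x

    P = proj₁ reach
    x∈P = proj₁ (proj₂ reach)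
    closed = proj₁ (proj₂ (proj₂ reach))
    least = proj₂ (proj₂ (proj₂ reach))

    -- Even positions on the alternating path from `x`. It starts in the first matching, because the
    -- only `R₂`-edge at `x` is `xy`, which is not yet done.
    data Even : Fin n → Set where
      start : Even x
      next  : ∀ {u v w} → Even u → R₁ u v → Done xs v w → Even w

    OnPath : Fin n → Set
    OnPath u = Even u ⊎ ∃[ w ] Even w × R₁ w u

    onPath-closed : Closed OnPath
    onPath-closed (inj₁ e) (inj₁ r) = inj₂ (_ , e , r)
    onPath-closed (inj₁ start) (inj₂ (r , d)) with refl ← M₂.functional xy r = contradiction d ¬xy-done
    onPath-closed (inj₁ (next e r (r′ , _))) (inj₂ (r″ , _))
      with refl ← M₂.functional (M₂.symmetric r′) r″ = inj₂ (_ , e , r)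
    onPath-closed (inj₂ (w , e , r)) (inj₁ r′) with refl ← M₁.functional (M₁.symmetric r) r′ = inj₁ e
    onPath-closed (inj₂ (w , e , r)) (inj₂ d) = inj₁ (next e r d)

    even-colour : ∀ {u} → Even u → κ u ≡ κ x
    even-colour start = refl
    even-colour (next e r d) = trans (sym (≢-≢⇒≡ (proj₁ proper r) (proj₂ proper d))) (even-colour e)

    -- At an even position `y` would be entered through a done `R₂`-edge, necessarily `xy`. At an
    -- odd position its predecessor would have the colour of `x`, which is that of `y`, against
    -- properness on the first matching.
    y∉P : y ∉ˢ P
    y∉P y∈P with least OnPath (inj₁ start) onPath-closed y∈P
    ... | inj₁ start = M₂.irrefl xy
    ... | inj₁ (next e r (r′ , d)) with refl ← M₂.functional (M₂.symmetric xy) (M₂.symmetric r′) =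
      ¬xy-done d
    ... | inj₂ (w , e , r) = proj₁ proper r (trans (even-colour e) mono)

    preserved : ∀ {u v} → E u v → κ u ≢ κ v → flip-on (_∈ˢ? P) κ u ≢ flip-on (_∈ˢ? P) κ v
    preserved e = flip-preserves-≢ (_∈ˢ? P) κ (λ u∈ → closed u∈ e) (λ v∈ → closed v∈ (E-sym e))

    xy-proper : flip-on (_∈ˢ? P) κ x ≢ flip-on (_∈ˢ? P) κ y
    xy-proper eq = not-¬ {κ x} refl
      (trans mono (trans (sym (flip-∉ (_∈ˢ? P) κ y∉P)) (trans (sym eq) (flip-∈ (_∈ˢ? P) κ x∈P))))

  extend : ∀ x {xs} → ∃ (Proper xs) → ∃ (Proper (x ∷ xs))
  extend x {xs} (κ , proper₁ , proper₂) with any? (M₂.dec x)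
  ... | no isolated = κ , proper₁ , λ
    { (r , inj₁ (here refl)) → contradiction (_ , r) isolated
    ; (r , inj₂ (here refl)) → contradiction (_ , M₂.symmetric r) isolated
    ; (r , inj₁ (there d)) → proper₂ (r , inj₁ d)
    ; (r , inj₂ (there d)) → proper₂ (r , inj₂ d) }
  ... | yes (y , xy) = fix (κ x Bool.≟ κ y)
    where
    add : ∀ κ → (∀ {u v} → R₁ u v → κ u ≢ κ v) → (∀ {u v} → Done xs u v → κ u ≢ κ v) → κ x ≢ κ y →
          Proper (x ∷ xs) κ
    add κ p₁ p₂ κ≢ = p₁ , λ
      { (r , inj₁ (here refl)) → λ eq → κ≢ (trans eq (cong κ (M₂.functional r xy)))
      ; (r , inj₂ (here refl)) → λ eq → κ≢ (trans (sym eq) (cong κ (M₂.functional (M₂.symmetric r) xy)))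
      ; (r , inj₁ (there d)) → p₂ (r , inj₁ d)
      ; (r , inj₂ (there d)) → p₂ (r , inj₂ d) }
    fix : Dec (κ x ≡ κ y) → ∃ (Proper (x ∷ xs))
    fix (no κ≢) = κ , add κ proper₁ proper₂ κ≢
    fix (yes mono) = flip-on (_∈ˢ? P) κ , add (flip-on (_∈ˢ? P) κ) (λ r → preserved (inj₁ r) (proper₁ r))
                       (λ d → preserved (inj₂ d) (proper₂ d)) xy-proper
      where open Exchange xy (proper₁ , proper₂) mono

  two-colouring : Σ (Fin n → Bool) λ κ → (∀ {u v} → R₁ u v → κ u ≢ κ v) × (∀ {u v} → R₂ u v → κ u ≢ κ v)
  two-colouring = let (κ , p₁ , p₂) = go (allFin n) in κ , p₁ , λ {u} r → p₂ (r , inj₁ (∈-allFin u))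
    where
    go : ∀ xs → ∃ (Proper xs)
    go [] = initial
    go (x ∷ xs) = extend x (go xs)

-- Colouring with three colours

third-colour : ∀ (i j : Fin 3) → ∃[ k ] k ≢ i × k ≢ j
third-colour zero zero = suc zero , (λ ()) , (λ ())
third-colour zero (suc zero) = suc (suc zero) , (λ ()) , (λ ())
third-colour zero (suc (suc zero)) = suc zero , (λ ()) , (λ ())
third-colour (suc zero) zero = suc (suc zero) , (λ ()) , (λ ())
third-colour (suc zero) (suc _) = zero , (λ ()) , (λ ())
third-colour (suc (suc zero)) zero = suc zero , (λ ()) , (λ ())
third-colour (suc (suc zero)) (suc _) = zero , (λ ()) , (λ ())

-- By pigeonhole some v has at most one preimage, hence at most two neighbours; delete it.
functional-graph-3-colourable : ∀ {n} (f : Fin n → Fin n) →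
  Σ (Fin n → Fin 3) λ c → ∀ v → f v ≢ v → c v ≢ c (f v)
functional-graph-3-colourable {zero} f = (λ ()) , λ ()
functional-graph-3-colourable {suc m} f =
  delete (¬∀⟶∃¬ (suc m) TwoPreimages twoPreimages? not-all)
  where
  TwoPreimages : Fin (suc m) → Set
  TwoPreimages v = ∃₂ λ x y → x ≢ y × f x ≡ v × f y ≡ v
  twoPreimages? : ∀ v → Dec (TwoPreimages v)
  twoPreimages? v = any? λ x → any? λ y → ¬? (x ≟ y) ×-dec (f x ≟ v) ×-dec (f y ≟ v)

  not-all : ¬ (∀ v → TwoPreimages v)
  not-all two = ℕ.1+n≰n (injective⇒≤ k-injective)
    where
    -- The first preimages of all vertices and the second preimage of `zero`: one more than there
    -- are vertices, all distinct.
    k : Fin (suc (suc m)) → Fin (suc m)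
    k zero = proj₁ (proj₂ (two zero))
    k (suc v) = proj₁ (two v)
    fk : ∀ v → f (k (suc v)) ≡ v
    fk v = proj₁ (proj₂ (proj₂ (proj₂ (two v))))
    fk₀ : f (k zero) ≡ zero
    fk₀ = proj₂ (proj₂ (proj₂ (proj₂ (two zero))))
    k₀≢ : ∀ v → k zero ≢ k (suc v)
    k₀≢ v eq with refl ← trans (sym (fk v)) (trans (cong f (sym eq)) fk₀) =
      proj₁ (proj₂ (proj₂ (two zero))) (sym eq)
    k-injective : ∀ {i j} → k i ≡ k j → i ≡ j
    k-injective {zero} {zero} eq = refl
    k-injective {zero} {suc j} eq = contradiction eq (k₀≢ j)
    k-injective {suc i} {zero} eq = contradiction (sym eq) (k₀≢ i)
    k-injective {suc i} {suc j} eq = cong suc (trans (sym (fk i)) (trans (cong f eq) (fk j)))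

  delete : ∃[ v ] ¬ TwoPreimages v → Σ (Fin (suc m) → Fin 3) λ c → ∀ v → f v ≢ v → c v ≢ c (f v)
  delete (v , ¬two) = c , proper
    where
    -- A vertex mapped to the deleted `v` becomes a fixed point of `f′`, which carries no
    -- constraint; its edge to `v` is respected when `v` is coloured.
    into : Fin m → (w : Fin (suc m)) → Dec (v ≡ w) → Fin m
    into x w (yes _) = x
    into x w (no v≢w) = punchOut v≢w
    f′ : Fin m → Fin m
    f′ x = into x (f (punchIn v x)) (v ≟ f (punchIn v x))

    c′ = proj₁ (functional-graph-3-colourable f′)
    proper′ = proj₂ (functional-graph-3-colourable f′)

    lift : (d : Fin 3) → ∀ w → Dec (v ≡ w) → Fin 3
    lift d w (yes _) = d
    lift d w (no v≢w) = c′ (punchOut v≢w)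

    preimage : Dec (∃[ x ] f x ≡ v × v ≢ x) → Fin 3
    preimage (yes (x , _ , v≢x)) = c′ (punchOut v≢x)
    preimage (no _) = zero
    pre? = any? λ x → (f x ≟ v) ×-dec ¬? (v ≟ x)

    -- Avoids the colours of `f v` and of the at most one preimage other than `v`; where one of them
    -- is missing, the default `zero` does no harm.
    chosen = third-colour (lift zero (f v) (v ≟ f v)) (preimage pre?)
    d = proj₁ chosen

    c : Fin (suc m) → Fin 3
    c w = lift d w (v ≟ w)

    proper : ∀ w → f w ≢ w → c w ≢ c (f w)
    proper w fw≢w eq with v ≟ w
    proper w fw≢w eq | yes refl with v ≟ f v | proj₁ (proj₂ chosen)
    ... | yes v≡fv | _ = fw≢w (sym v≡fv)
    ... | no _ | d≢ = d≢ eq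
    proper w fw≢w eq | no v≢w with v ≟ f w
    ... | yes v≡fw with pre? | proj₂ (proj₂ chosen)
    ... | no ¬pre | _ = ¬pre (w , sym v≡fw , v≢w)
    ... | yes (x , fx≡v , v≢x) | d≢ with x ≟ w
    ...   | yes refl = d≢ (trans (sym eq) (cong c′ (punchOut-cong v refl)))
    ...   | no x≢w = ¬two (x , w , x≢w , fx≡v , sym v≡fw)
    proper w fw≢w eq | no v≢w | no v≢fw = proper′ w′ f′w′≢w′ (trans eq (cong c′ (sym f′w′≡)))
      where
      w′ = punchOut v≢w
      f′w′≡ : f′ w′ ≡ punchOut v≢fw
      f′w′≡ with v ≟ f (punchIn v w′)
      ... | yes v≡ = contradiction (trans v≡ (cong f (punchIn-punchOut v≢w))) v≢fw
      ... | no _ = punchOut-cong v (cong f (punchIn-punchOut v≢w))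
      f′w′≢w′ : f′ w′ ≢ w′
      f′w′≢w′ e = fw≢w (punchOut-injective v≢fw v≢w (trans (sym f′w′≡) e))

AtMostTwo : ∀ {n} → (Fin n → Set) → Set
AtMostTwo Q = ∀ {u v w} → Q u → Q v → Q w → u ≢ v → u ≢ w → v ≢ w → ⊥

-- If every colour occurred on `Q`, three vertices of different colours would be three distinct
-- elements of `Q`.
free-colour : ∀ {n} {Q : Fin n → Set} → (∀ u → Dec (Q u)) → AtMostTwo Q → (c : Fin n → Fin 3) →
  ∃[ i ] (∀ {u} → Q u → c u ≢ i)
free-colour Q? ≤2 c with all? (λ i → any? λ u → Q? u ×-dec (c u ≟ i))
... | yes used =
  let (u₀ , q₀ , c₀) = used zero
      (u₁ , q₁ , c₁) = used (suc zero)
      (u₂ , q₂ , c₂) = used (suc (suc zero))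
      differ : ∀ {u v i j} → c u ≡ i → c v ≡ j → i ≢ j → u ≢ v
      differ cu cv i≢j u≡v = i≢j (trans (sym cu) (trans (cong c u≡v) cv))
  in ⊥-elim (≤2 q₀ q₁ q₂ (differ c₀ c₁ λ ()) (differ c₀ c₂ λ ()) (differ c₁ c₂ λ ()))
... | no ¬used =
  let (i , unused) = ¬∀⟶∃¬ 3 _ (λ i → any? λ u → Q? u ×-dec (c u ≟ i)) ¬used
  in i , λ q cu≡i → unused (_ , q , cu≡i)

-- `H` is precoloured by `c₀`. A vertex outside `H` has at most two conflicts altogether, so the
-- order of colouring does not matter.
module Greedy {n} {C : Fin n → Fin n → Set} (C? : ∀ u v → Dec (C u v))
  (C-sym : ∀ {u v} → C u v → C v u) (C-irrefl : ∀ {u} → ¬ C u u)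
  {H : Fin n → Set} (H? : ∀ u → Dec (H u))
  (c₀ : Fin n → Fin 3) (c₀-proper : ∀ {u v} → C u v → H u → H v → c₀ u ≢ c₀ v)
  (≤2 : ∀ v → ¬ H v → AtMostTwo (C v)) where

  private
    open DecMembership (_≟_ {n}) using (_∈?_)

    Coloured : List (Fin n) → Fin n → Set
    Coloured xs u = H u ⊎ u ∈ xs

    Proper : List (Fin n) → (Fin n → Fin 3) → Set
    Proper xs c = ∀ {u v} → C u v → Coloured xs u → Coloured xs v → c u ≢ c v

    coloured? : ∀ xs u → Dec (Coloured xs u)
    coloured? xs u = H? u ⊎-dec (u ∈? xs)

    shrink : ∀ {x xs} → Coloured xs x → ∀ {u} → Coloured (x ∷ xs) u → Coloured xs u
    shrink cx (inj₁ h) = inj₁ h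
    shrink cx (inj₂ (here refl)) = cx
    shrink cx (inj₂ (there u∈)) = inj₂ u∈

    old : ∀ {x xs u} → x ≢ u → Coloured (x ∷ xs) u → Coloured xs u
    old _ (inj₁ h) = inj₁ h
    old x≢u (inj₂ (here refl)) = contradiction refl x≢u
    old _ (inj₂ (there u∈)) = inj₂ u∈

    extend : ∀ x {xs} → ∃ (Proper xs) → ∃ (Proper (x ∷ xs))
    extend x {xs} (c , proper) with coloured? xs x
    ... | yes cx = c , λ e cu cv → proper e (shrink cx cu) (shrink cx cv)
    ... | no ¬cx = c′ , proper′
      where
      Q? = λ u → C? x u ×-dec coloured? xs u
      free = free-colour Q? (λ a b d → ≤2 x (¬cx ∘ inj₁) (proj₁ a) (proj₁ b) (proj₁ d)) c
      c′ : Fin n → Fin 3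
      c′ u with x ≟ u
      ... | yes _ = proj₁ free
      ... | no _ = c u
      proper′ : Proper (x ∷ xs) c′
      proper′ {u} {v} e cu cv eq with x ≟ u | x ≟ v
      ... | yes refl | yes refl = C-irrefl e
      ... | yes refl | no x≢v = proj₂ free (e , old x≢v cv) (sym eq)
      ... | no x≢u | yes refl = proj₂ free (C-sym e , old x≢u cu) eq
      ... | no x≢u | no x≢v = proper e (old x≢u cu) (old x≢v cv) eq

    go : ∀ xs → ∃ (Proper xs)
    go [] = c₀ , λ { e (inj₁ hu) (inj₁ hv) → c₀-proper e hu hv ; e (inj₂ ()) _ ; e _ (inj₂ ()) }
    go (x ∷ xs) = extend x (go xs)

  colouring : Σ (Fin n → Fin 3) λ c → ∀ {u v} → C u v → c u ≢ c v
  colouring = let (c , proper) = go (allFin n)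
              in c , λ {u} {v} e → proper e (inj₂ (∈-allFin u)) (inj₂ (∈-allFin v))

-- Counting with repetition-free lists

lookup-injective : ∀ {A : Set} {xs : List A} → Unique xs → ∀ {i j} → lookup xs i ≡ lookup xs j → i ≡ j
lookup-injective (_ ∷ _) {zero} {zero} _ = refl
lookup-injective (x∉ ∷ _) {zero} {suc j} eq = contradiction eq (All.lookup x∉ (∈-lookup j))
lookup-injective (x∉ ∷ _) {suc i} {zero} eq = contradiction (sym eq) (All.lookup x∉ (∈-lookup i))
lookup-injective (_ ∷ uniq) {suc i} {suc j} eq = cong suc (lookup-injective uniq eq)

unique-⊆⇒length≤ : ∀ {A : Set} {xs ys : List A} → Unique xs → All (_∈ ys) xs → length xs ℕ.≤ length ys
unique-⊆⇒length≤ {xs = xs} {ys} uniq xs⊆ys = injective⇒≤ {f = position} position-injective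
  where
  position : Fin (length xs) → Fin (length ys)
  position i = index (All.lookup xs⊆ys (∈-lookup i))
  position-injective : Injective _≡_ _≡_ position
  position-injective {i} {j} eq = lookup-injective uniq
    (trans (lookup-index (All.lookup xs⊆ys (∈-lookup i)))
      (trans (cong (lookup ys) eq) (sym (lookup-index (All.lookup xs⊆ys (∈-lookup j))))))

-- Neighbours, inner and outer edges, bounded distance

module Neighbourhoods (G : Graph) where
  open Graph G renaming (sym to adj-sym)

  V : Set
  V = Fin n

  infix 4 _~_ _~?_
  _~_ : V → V → Set
  u ~ v = Adj G u v

  _~?_ : ∀ u v → Dec (u ~ v)
  u ~? v = adj u v Bool.≟ true

  ~-sym : ∀ {u v} → u ~ v → v ~ u
  ~-sym {u} {v} e = trans (adj-sym v u) e

  ~-irrefl : ∀ {u} → ¬ u ~ u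
  ~-irrefl {u} e with () ← trans (sym e) (irr u)

  ~⇒≢ : ∀ {u v} → u ~ v → u ≢ v
  ~⇒≢ e refl = ~-irrefl e

  nbrs : V → List V
  nbrs v = filter (v ~?_) (allFin n)

  degree≡length : ∀ v → degree G v ≡ length (nbrs v)
  degree≡length v = count (allFin n)
    where
    count : ∀ xs → sum (map (λ u → if adj v u then 1 else 0) xs) ≡ length (filter (v ~?_) xs)
    count [] = refl
    count (x ∷ xs) with adj v x
    ... | true = cong ℕ.suc (count xs)
    ... | false = count xs

  ∈-nbrs : ∀ {v u} → v ~ u → u ∈ nbrs v
  ∈-nbrs {v} {u} e = ∈-filter⁺ (v ~?_) (∈-allFin u) e

  ≤degree : ∀ {v xs} → Unique xs → All (v ~_) xs → length xs ℕ.≤ degree G v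
  ≤degree {v} {xs} uniq adjacent =
    subst (length xs ℕ.≤_) (sym (degree≡length v)) (unique-⊆⇒length≤ uniq (All.map ∈-nbrs adjacent))

  degree3⇒nbrs : ∀ {v} → degree G v ≡ 3 →
    ∃[ x ] ∃[ y ] ∃[ z ] x ≢ y × x ≢ z × y ≢ z × v ~ x × v ~ y × v ~ z
  degree3⇒nbrs {v} d = go (nbrs v) (trans (sym (degree≡length v)) d) (filter⁺ (v ~?_) (allFin⁺ n))
      (λ u∈ → proj₂ (∈-filter⁻ (v ~?_) {xs = allFin n} u∈))
    where
    go : ∀ xs → length xs ≡ 3 → Unique xs → (∀ {u} → u ∈ xs → v ~ u) →
      ∃[ x ] ∃[ y ] ∃[ z ] x ≢ y × x ≢ z × y ≢ z × v ~ x × v ~ y × v ~ z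
    go (x ∷ y ∷ z ∷ []) refl ((x≢y ∷ x≢z ∷ []) ∷ (y≢z ∷ []) ∷ _) adjacent =
      x , y , z , x≢y , x≢z , y≢z ,
      adjacent (here refl) , adjacent (there (here refl)) , adjacent (there (there (here refl)))

  CommonNbr Inner Outer : V → V → Set
  CommonNbr u v = ∃[ w ] u ~ w × v ~ w
  Inner u v = u ~ v × CommonNbr u v
  Outer u v = u ~ v × ¬ CommonNbr u v

  OnTriangle HasOuter : V → Set
  OnTriangle v = ∃[ p ] ∃[ q ] v ~ p × v ~ q × p ~ q
  HasOuter v = ∃ (Outer v)

  CommonNbr? : ∀ u v → Dec (CommonNbr u v)
  CommonNbr? u v = any? λ w → (u ~? w) ×-dec (v ~? w)

  OnTriangle? : ∀ v → Dec (OnTriangle v)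
  OnTriangle? v = any? λ p → any? λ q → (v ~? p) ×-dec (v ~? q) ×-dec (p ~? q)

  HasOuter? : ∀ v → Dec (HasOuter v)
  HasOuter? v = any? λ w → (v ~? w) ×-dec ¬? (CommonNbr? v w)

  CommonNbr-sym : ∀ {u v} → CommonNbr u v → CommonNbr v u
  CommonNbr-sym (w , a , b) = w , b , a

  Inner-sym : ∀ {u v} → Inner u v → Inner v u
  Inner-sym (e , c) = ~-sym e , CommonNbr-sym c

  Outer-sym : ∀ {u v} → Outer u v → Outer v u
  Outer-sym (e , c) = ~-sym e , c ∘ CommonNbr-sym

  Inner⇒OnTriangle : ∀ {u v} → Inner u v → OnTriangle u
  Inner⇒OnTriangle (e , w , a , b) = _ , w , e , a , b

  ¬HasOuter⇒Inner : ∀ {u v} → ¬ HasOuter u → u ~ v → Inner u v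
  ¬HasOuter⇒Inner {u} {v} ¬o e with CommonNbr? u v
  ... | yes c = e , c
  ... | no ¬c = contradiction (v , e , ¬c) ¬o

  -- Distance at most `k` in a decidable form: a stop is allowed at every level, which covers all
  -- shorter walks.
  Within : ℕ → V → V → Set
  Within ℕ.zero u w = u ≡ w
  Within (ℕ.suc k) u w = u ≡ w ⊎ ∃[ s ] u ~ s × Within k s w

  Within? : ∀ k u w → Dec (Within k u w)
  Within? ℕ.zero u w = u ≟ w
  Within? (ℕ.suc k) u w = (u ≟ w) ⊎-dec any? (λ s → (u ~? s) ×-dec Within? k s w)

  Within-refl : ∀ k {u} → Within k u u
  Within-refl ℕ.zero = refl
  Within-refl (ℕ.suc k) = inj₁ refl

  Within-snoc : ∀ k {u w t} → Within k u w → w ~ t → Within (ℕ.suc k) u t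
  Within-snoc ℕ.zero refl e = inj₂ (_ , e , refl)
  Within-snoc (ℕ.suc k) (inj₁ refl) e = inj₂ (_ , e , Within-refl (ℕ.suc k))
  Within-snoc (ℕ.suc k) (inj₂ (s , e′ , d)) e = inj₂ (s , e′ , Within-snoc k d e)

  Within-sym : ∀ k {u w} → Within k u w → Within k w u
  Within-sym ℕ.zero refl = refl
  Within-sym (ℕ.suc k) (inj₁ refl) = inj₁ refl
  Within-sym (ℕ.suc k) (inj₂ (s , e , d)) = Within-snoc k (Within-sym k d) (~-sym e)

  walk⇒Within : ∀ {u w m} k → m ℕ.≤ k → Walk G u w m → Within k u w
  walk⇒Within k _ here = Within-refl k
  walk⇒Within (ℕ.suc k) (ℕ.s≤s m≤k) (step e p) = inj₂ (_ , e , walk⇒Within k m≤k p)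

-- Local structure under the degree bound and saturation

module Structure (G : Graph) (subcubic : Subcubic G) (saturated : Saturated3 G 2)
  (triangles : ∀ {v} → degree G v ≡ 3 → Neighbourhoods.OnTriangle G v) where
  open Graph G using (n)
  open Neighbourhoods G public

  deg : V → ℕ
  deg = degree G

  third : ∀ {v a b c d} → v ~ a → v ~ b → v ~ c → a ≢ b → a ≢ c → b ≢ c → v ~ d → d ≡ a ⊎ d ≡ b ⊎ d ≡ c
  third {v} {a} {b} {c} {d} va vb vc a≢b a≢c b≢c vd with d ≟ a | d ≟ b | d ≟ c
  ... | yes p | _ | _ = inj₁ p
  ... | no _ | yes p | _ = inj₂ (inj₁ p)
  ... | no _ | no _ | yes p = inj₂ (inj₂ p)
  ... | no d≢a | no d≢b | no d≢c = contradiction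
    (ℕ.≤-trans (≤degree ((d≢a ∷ d≢b ∷ d≢c ∷ []) ∷ (a≢b ∷ a≢c ∷ []) ∷ (b≢c ∷ []) ∷ [] ∷ [])
                        (vd ∷ va ∷ vb ∷ vc ∷ []))
               (subcubic v)) λ { (ℕ.s≤s (ℕ.s≤s (ℕ.s≤s ()))) }

  third-unique : ∀ {v a b c d} → v ~ a → v ~ b → a ≢ b → v ~ c → c ≢ a → c ≢ b → v ~ d → d ≢ a → d ≢ b → c ≡ d
  third-unique va vb a≢b vc c≢a c≢b vd d≢a d≢b with third va vb vc a≢b (≢-sym c≢a) (≢-sym c≢b) vd
  ... | inj₁ p = contradiction p d≢a
  ... | inj₂ (inj₁ p) = contradiction p d≢b
  ... | inj₂ (inj₂ p) = sym p

  three⇒deg3 : ∀ {v a b c} → v ~ a → v ~ b → v ~ c → a ≢ b → a ≢ c → b ≢ c → deg v ≡ 3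
  three⇒deg3 {v} va vb vc a≢b a≢c b≢c = ℕ.≤-antisym (subcubic v)
    (≤degree ((a≢b ∷ a≢c ∷ []) ∷ (b≢c ∷ []) ∷ [] ∷ []) (va ∷ vb ∷ vc ∷ []))

  deg3⇒third : ∀ {v} → deg v ≡ 3 → ∀ a b → ∃[ e ] v ~ e × e ≢ a × e ≢ b
  deg3⇒third d a b with degree3⇒nbrs d
  ... | x , y , z , x≢y , x≢z , y≢z , vx , vy , vz with x ≟ a | x ≟ b | y ≟ a | y ≟ b | z ≟ a | z ≟ b
  ... | no p | no q | _ | _ | _ | _ = x , vx , p , q
  ... | _ | _ | no p | no q | _ | _ = y , vy , p , q
  ... | _ | _ | _ | _ | no p | no q = z , vz , p , q
  ... | yes refl | _ | yes refl | _ | _ | _ = contradiction refl x≢y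
  ... | yes refl | _ | _ | _ | yes refl | _ = contradiction refl x≢z
  ... | _ | _ | yes refl | _ | yes refl | _ = contradiction refl y≢z
  ... | _ | yes refl | _ | yes refl | _ | _ = contradiction refl x≢y
  ... | _ | yes refl | _ | _ | _ | yes refl = contradiction refl x≢z
  ... | _ | _ | _ | yes refl | _ | yes refl = contradiction refl y≢z

  heavy : ∀ {v a b c} → v ~ a → v ~ b → v ~ c → a ≢ b → a ≢ c → b ≢ c →
    deg a ≡ 3 → deg b ≡ 3 → deg c ≡ 3 → Heavy G v
  heavy {v} va vb vc a≢b a≢c b≢c da db dc =
    three⇒deg3 va vb vc a≢b a≢c b≢c , λ u vu → go (third va vb vc a≢b a≢c b≢c vu)
    where
    go : ∀ {u} → u ≡ _ ⊎ u ≡ _ ⊎ u ≡ _ → deg u ≡ 3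
    go (inj₁ refl) = da
    go (inj₂ (inj₁ refl)) = db
    go (inj₂ (inj₂ refl)) = dc

  ¬three-heavy : ∀ {v a b c} → Heavy G v → v ~ a → v ~ b → v ~ c → a ≢ b → a ≢ c → b ≢ c →
    Heavy G a → Heavy G b → Heavy G c → ⊥
  ¬three-heavy {v} {a} {b} {c} hv va vb vc a≢b a≢c b≢c ha hb hc =
    saturated v hv (lookup (a ∷ b ∷ c ∷ []))
      (lookup-injective ((a≢b ∷ a≢c ∷ []) ∷ (b≢c ∷ []) ∷ [] ∷ []))
      λ { 0F → va , ha ; 1F → vb , hb ; 2F → vc , hc }

  -- All four degrees are 3 already, so no edge leaves the four vertices; all of them are heavy, and
  -- each has three heavy neighbours.
  K4-free : ∀ {a b c d} → a ~ b → a ~ c → a ~ d → b ~ c → b ~ d → c ~ d → ⊥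
  K4-free ab ac ad bc bd cd =
    ¬three-heavy (heavy ab ac ad b≢c b≢d c≢d db dc dd) ab ac ad b≢c b≢d c≢d
      (heavy (~-sym ab) bc bd a≢c a≢d c≢d da dc dd)
      (heavy (~-sym ac) (~-sym bc) cd a≢b a≢d b≢d da db dd)
      (heavy (~-sym ad) (~-sym bd) (~-sym cd) a≢b a≢c b≢c da db dc)
    where
    a≢b = ~⇒≢ ab
    a≢c = ~⇒≢ ac
    a≢d = ~⇒≢ ad
    b≢c = ~⇒≢ bc
    b≢d = ~⇒≢ bd
    c≢d = ~⇒≢ cd
    da = three⇒deg3 ab ac ad b≢c b≢d c≢d
    db = three⇒deg3 (~-sym ab) bc bd a≢c a≢d c≢d
    dc = three⇒deg3 (~-sym ac) (~-sym bc) cd a≢b a≢d b≢d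
    dd = three⇒deg3 (~-sym ad) (~-sym bd) (~-sym cd) a≢b a≢c b≢c

  outer-≢ : ∀ {v o p} → Outer v o → CommonNbr v p → p ≢ o
  outer-≢ (_ , ¬c) c refl = ¬c c

  outer-unique : ∀ {v o o′} → OnTriangle v → Outer v o → Outer v o′ → o ≡ o′
  outer-unique (p , q , vp , vq , pq) vo vo′ = third-unique vp vq (~⇒≢ pq)
    (proj₁ vo) (≢-sym (outer-≢ vo p-inner)) (≢-sym (outer-≢ vo q-inner))
    (proj₁ vo′) (≢-sym (outer-≢ vo′ p-inner)) (≢-sym (outer-≢ vo′ q-inner))
    where
    p-inner = q , vq , pq
    q-inner = p , vp , ~-sym pq

  -- The outer edge uses up the third place at `v`, so all inner edges at `v` belong to one
  -- triangle.
  inner-nbrs : ∀ {v p q s} → HasOuter v → v ~ p → v ~ q → p ~ q → Inner v s → s ≡ p ⊎ s ≡ q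
  inner-nbrs (o , vo) vp vq pq (vs , c) with third vp vq (proj₁ vo) (~⇒≢ pq)
      (outer-≢ vo (_ , vq , pq)) (outer-≢ vo (_ , vp , ~-sym pq)) vs
  ... | inj₁ e = inj₁ e
  ... | inj₂ (inj₁ e) = inj₂ e
  ... | inj₂ (inj₂ refl) = contradiction c (proj₂ vo)

  hasO⇒deg3 : ∀ {v} → OnTriangle v → HasOuter v → deg v ≡ 3
  hasO⇒deg3 (p , q , vp , vq , pq) (o , vo) = three⇒deg3 vp vq (proj₁ vo) (~⇒≢ pq)
      (outer-≢ vo (_ , vq , pq)) (outer-≢ vo (_ , vp , ~-sym pq))

  -- Transversals of the triangles and bipartiteness of the rest

  record IsTransversal (Y : V → Set) : Set where
    field
      dec : ∀ v → Dec (Y v)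
      hit : ∀ {a b c} → a ~ b → a ~ c → b ~ c → Y a ⊎ Y b ⊎ Y c
      -- Any two vertices of a triangle span an inner edge, so with `hit` exactly one vertex of each
      -- triangle is chosen.
      one : ∀ {u w} → Y u → Y w → Inner u w → ⊥

  module Bipartite {Y : V → Set} (transversal : IsTransversal Y) where
    open IsTransversal transversal renaming (dec to Y?)

    Rest : V → Set
    Rest v = OnTriangle v × ¬ Y v

    Rest? : ∀ v → Dec (Rest v)
    Rest? v = OnTriangle? v ×-dec ¬? (Y? v)

    Matable : V → V → Set
    Matable v u = ∃[ y ] Y y × v ~ y × u ~ y

    Matable? : ∀ v u → Dec (Matable v u)
    Matable? v u = any? λ y → Y? y ×-dec (v ~? y) ×-dec (u ~? y)

    Exit : V → Set
    Exit v = ∃[ w ] Rest w × v ~ w × ¬ Matable v w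

    Exit? : ∀ v → Dec (Exit v)
    Exit? v = any? λ w → Rest? w ×-dec (v ~? w) ×-dec ¬? (Matable? v w)

    -- ρ orders the vertices, those with an exit first; the only choice it has to make is between the two ends
    -- of a diamond, where the middle vertex left by Y is matched to the preferred end.
    grade : ∀ {v} → Dec (Exit v) → Fin 2
    grade (yes _) = 0F
    grade (no _) = 1F

    ρ : V → Fin (2 ℕ.* n)
    ρ v = combine (grade (Exit? v)) v

    ρ-injective : ∀ {u v} → ρ u ≡ ρ v → u ≡ v
    ρ-injective {u} {v} = Fin.combine-injectiveʳ (grade (Exit? u)) u (grade (Exit? v)) v

    -- The grade is the leading digit of `ρ`, so no vertex without an exit precedes one that has an
    -- exit.
    exit-≤ : ∀ {u v} → ρ u Fin.≤ ρ v → Exit v → Exit u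
    exit-≤ {u} {v} le ex with Exit? u | Exit? v
    ... | yes ex′ | _ = ex′
    ... | no _ | no ¬ex = contradiction ex ¬ex
    ... | no _ | yes _ = contradiction le (ℕ.<⇒≱ (Fin.combine-monoˡ-< {m = 2} {i = 0F} {j = 1F} v u (ℕ.s≤s ℕ.z≤n)))

    Best : V → V → Set
    Best v u = ∀ w → Rest w → v ~ w → Matable v w → ρ u Fin.≤ ρ w

    Best? : ∀ v u → Dec (Best v u)
    Best? v u = all? λ w → Rest? w →-dec ((v ~? w) →-dec (Matable? v w →-dec (ρ u Fin.≤? ρ w)))

    -- In `R₁` each end is the `ρ`-least candidate of the other, which makes `R₁` a matching
    -- outright. That the leftover edges form one too needs the structure of the graph.
    R₁ R₂ : V → V → Set
    R₁ v u = Rest v × Rest u × v ~ u × Matable v u × Best v u × Best u v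
    R₂ v u = Rest v × Rest u × v ~ u × ¬ R₁ v u

    R₁? : ∀ v u → Dec (R₁ v u)
    R₁? v u = Rest? v ×-dec Rest? u ×-dec (v ~? u) ×-dec Matable? v u ×-dec Best? v u ×-dec Best? u v

    R₁-sym : ∀ {v u} → R₁ v u → R₁ u v
    R₁-sym (sv , su , e , (y , Yy , vy , uy) , b , b′) = su , sv , ~-sym e , (y , Yy , uy , vy) , b′ , b

    ≢Y : ∀ {u y} → Rest u → Y y → u ≢ y
    ≢Y (_ , ¬Yu) Yy refl = ¬Yu Yy

    module _ {v u y} (sv : Rest v) (su : Rest u) (Yy : Y y) (vy : v ~ y) (uy : u ~ y) (vu : v ~ u) where
      private
        u≢y = ≢Y su Yy

      shared : ∀ {w} → Rest w → v ~ w → w ≢ u → Matable v w → w ~ y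
      shared sw vw w≢u (y′ , Yy′ , vy′ , wy′) with third vy vu vw (≢-sym u≢y) (≢-sym (≢Y sw Yy)) (≢-sym w≢u) vy′
      ... | inj₁ refl = wy′
      ... | inj₂ (inj₁ refl) = contradiction refl (≢Y su Yy′)
      ... | inj₂ (inj₂ refl) = contradiction refl (≢Y sw Yy′)

    module _ {v u y} (sv : Rest v) (su : Rest u) (Yy : Y y) (vy : v ~ y) (uy : u ~ y) (vu : v ~ u) where
      private
        u≢y = ≢Y su Yy

      -- `v` and `y` are the middle of a diamond with ends `u` and `w`, and `v` prefers `u`. In turn
      -- `u` has no candidate but `v`: another one would be adjacent to `y`, hence equal to `w`,
      -- giving a K4.
      diamond-matched : ∀ {w} → Rest w → v ~ w → w ≢ u → w ~ y → ρ u Fin.≤ ρ w → R₁ v u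
      diamond-matched {w} sw vw w≢u wy u≤w = sv , su , vu , (y , Yy , vy , uy) , best , best′
        where
        best : Best v u
        best z sz vz _ with third vy vu vw (≢-sym u≢y) (≢-sym (≢Y sw Yy)) (≢-sym w≢u) vz
        ... | inj₁ refl = contradiction refl (≢Y sz Yy)
        ... | inj₂ (inj₁ refl) = Fin.≤-refl
        ... | inj₂ (inj₂ refl) = u≤w
        best′ : Best u v
        best′ z sz uz c with z ≟ v
        ... | yes refl = Fin.≤-refl
        ... | no z≢v with third (~-sym vy) (~-sym uy) (~-sym wy) (~⇒≢ vu) (~⇒≢ vw) (≢-sym w≢u)
                            (~-sym (shared su sv Yy uy vy (~-sym vu) sz uz z≢v c))
        ... | inj₁ refl = contradiction refl z≢v
        ... | inj₂ (inj₁ refl) = contradiction uz ~-irrefl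
        ... | inj₂ (inj₂ refl) = ⊥-elim (K4-free vy vu vw (~-sym uy) (~-sym wy) uz)

      -- `w` lies on a triangle that avoids `v`: a common neighbour of `v` and `w` would be `y`,
      -- making them matable, or `u`, which is excluded. So `v` is a third neighbour.
      exit-deg3 : ∀ {w} → Rest w → v ~ w → ¬ Matable v w → ¬ u ~ w → deg w ≡ 3
      exit-deg3 {w} ((p , q , wp , wq , pq) , ¬Yw) vw ¬c ¬uw =
        three⇒deg3 wp wq (~-sym vw) (~⇒≢ pq) (λ { refl → ¬v wq pq }) (λ { refl → ¬v wp (~-sym pq) })
        where
        w≢u : w ≢ u
        w≢u refl = ¬c (y , Yy , vy , uy)
        w≢y : w ≢ y
        w≢y refl = ¬Yw Yy
        ¬v : ∀ {r} → w ~ r → v ~ r → ⊥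
        ¬v wr vr with third vy vu vw (≢-sym u≢y) (≢-sym w≢y) (≢-sym w≢u) vr
        ... | inj₁ refl = ¬c (y , Yy , vy , wr)
        ... | inj₂ (inj₁ refl) = ¬uw (~-sym wr)
        ... | inj₂ (inj₂ refl) = ~-irrefl wr

    module _ {v u w y} (sv : Rest v) (su : Rest u) (sw : Rest w) (Yy : Y y)
      (vy : v ~ y) (uy : u ~ y) (vu : v ~ u) (vw : v ~ w) (w≢u : w ≢ u) where
      private
        u≢y = ≢Y su Yy
        v≢y = ≢Y sv Yy
        w≢y = ≢Y sw Yy

      -- If both ends of a diamond had an exit, its middle vertex y would have three heavy neighbours.
      exit-matched : ¬ Matable v w → R₁ v u
      exit-matched ¬c = sv , su , vu , (y , Yy , vy , uy) , best , best′
        where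
        best : Best v u
        best z sz vz c with third vy vu vw (≢-sym u≢y) (≢-sym w≢y) (≢-sym w≢u) vz
        ... | inj₁ refl = contradiction refl (≢Y sz Yy)
        ... | inj₂ (inj₁ refl) = Fin.≤-refl
        ... | inj₂ (inj₂ refl) = contradiction c ¬c
        best′ : Best u v
        best′ z sz uz c with z ≟ v
        ... | yes refl = Fin.≤-refl
        ... | no z≢v with Fin.≤-total (ρ v) (ρ z)
        ... | inj₁ le = le
        ... | inj₂ le = ⊥-elim (no-exit (exit-≤ le (w , sw , vw , ¬c)))
          where
          zy : z ~ y
          zy = shared su sv Yy uy vy (~-sym vu) sz uz z≢v c
          no-exit : ¬ Exit z
          no-exit (w₂ , sw₂ , zw₂ , ¬c₂) =
            ¬three-heavy (heavy (~-sym vy) (~-sym uy) (~-sym zy) v≢u v≢z u≢z dv du dz)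
              (~-sym vy) (~-sym uy) (~-sym zy) v≢u v≢z u≢z
              (heavy vy vu vw (≢-sym u≢y) (≢-sym w≢y) (≢-sym w≢u) dy du dw)
              (heavy uy (~-sym vu) uz (≢-sym v≢y) (≢-sym z≢y) v≢z dy dv dz)
              (heavy zy (~-sym uz) zw₂ (≢-sym u≢y) (≢-sym w₂≢y) (≢-sym w₂≢u) dy du dw₂)
            where
            v≢u = ~⇒≢ vu
            v≢z = ≢-sym z≢v
            u≢z = ~⇒≢ uz
            z≢y = ≢Y sz Yy
            w₂≢y = ≢Y sw₂ Yy
            w₂≢u : w₂ ≢ u
            w₂≢u refl = ¬c₂ (y , Yy , zy , uy)
            dv = three⇒deg3 vy vu vw (≢-sym u≢y) (≢-sym w≢y) (≢-sym w≢u)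
            du = three⇒deg3 uy (~-sym vu) uz (≢-sym v≢y) (≢-sym z≢y) v≢z
            dz = three⇒deg3 zy (~-sym uz) zw₂ (≢-sym u≢y) (≢-sym w₂≢y) (≢-sym w₂≢u)
            dy = three⇒deg3 (~-sym vy) (~-sym uy) (~-sym zy) v≢u v≢z u≢z
            dw = exit-deg3 sv su Yy vy uy vu sw vw ¬c λ uw →
              [ w≢y , [ (λ { refl → ~-irrefl vw }) , (λ { refl → ¬c (y , Yy , vy , zy) }) ]′ ]′
                (third uy (~-sym vu) uz (≢-sym v≢y) (≢-sym z≢y) v≢z uw)
            dw₂ = exit-deg3 sz su Yy zy uy (~-sym uz) sw₂ zw₂ ¬c₂ λ uw →
              [ w₂≢y , [ (λ { refl → ¬c₂ (y , Yy , zy , vy) }) , (λ { refl → ~-irrefl zw₂ }) ]′ ]′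
                (third uy (~-sym vu) uz (≢-sym v≢y) (≢-sym z≢y) v≢z uw)

      -- Either `w` is an exit of `v`, and then `v` is matched to `u`, or `u` and `w` are the ends
      -- of a diamond, and `v` is matched to the `ρ`-smaller one.
      R₂-at-most-one : ¬ R₁ v u → ¬ R₁ v w → ⊥
      R₂-at-most-one ¬vu ¬vw with Matable? v w
      ... | no ¬c = ¬vu (exit-matched ¬c)
      ... | yes c with shared sv su Yy vy uy vu sw vw w≢u c | Fin.≤-total (ρ u) (ρ w)
      ... | wy | inj₁ u≤w = ¬vu (diamond-matched sv su Yy vy uy vu sw vw w≢u wy u≤w)
      ... | wy | inj₂ w≤u = ¬vw (diamond-matched sv sw Yy vy wy vw su vu (≢-sym w≢u) uy w≤u)

    R₂-functional : ∀ {v u w} → R₂ v u → R₂ v w → u ≡ w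
    R₂-functional {v} {u} {w} (sv@((p , q , vp , vq , pq) , ¬Yv) , su , vu , ¬r) (_ , sw , vw , ¬r′) with u ≟ w
    ... | yes u≡w = u≡w
    ... | no u≢w = ⊥-elim (go (hit vp vq pq))
      where
      go′ : ∀ {y t} → Y y → v ~ y → v ~ t → y ~ t → ⊥
      go′ Yy vy vt yt with third vy vu vw (≢-sym (≢Y su Yy)) (≢-sym (≢Y sw Yy)) u≢w vt
      ... | inj₁ refl = ~-irrefl yt
      ... | inj₂ (inj₁ refl) = R₂-at-most-one sv su sw Yy vy (~-sym yt) vu vw (≢-sym u≢w) ¬r ¬r′
      ... | inj₂ (inj₂ refl) = R₂-at-most-one sv sw su Yy vy (~-sym yt) vw vu u≢w ¬r′ ¬r
      go : Y v ⊎ Y p ⊎ Y q → ⊥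
      go (inj₁ Yv) = ¬Yv Yv
      go (inj₂ (inj₁ Yp)) = go′ Yp vp vq pq
      go (inj₂ (inj₂ Yq)) = go′ Yq vq vp (~-sym pq)

    matching₁ : IsMatching R₁
    matching₁ = record
      { dec = R₁?
      ; symmetric = R₁-sym
      ; irrefl = λ (_ , _ , e , _) → ~-irrefl e
      ; functional = λ { (_ , sv , e , c , best , _) (_ , sw , e′ , c′ , best′ , _) →
          ρ-injective (Fin.≤-antisym (best _ sw e′ c′) (best′ _ sv e c)) } }

    matching₂ : IsMatching R₂
    matching₂ = record
      { dec = λ v u → Rest? v ×-dec Rest? u ×-dec (v ~? u) ×-dec ¬? (R₁? v u)
      ; symmetric = λ (sv , su , e , ¬r) → su , sv , ~-sym e , ¬r ∘ R₁-sym
      ; irrefl = λ (_ , _ , e , _) → ~-irrefl e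
      ; functional = R₂-functional }

    two-colouring : Σ (V → Bool) λ κ → ∀ {u v} → Rest u → Rest v → u ~ v → κ u ≢ κ v
    two-colouring = κ , proper
      where
      module T = TwoMatchings matching₁ matching₂
      κ = proj₁ T.two-colouring
      proper : ∀ {u v} → Rest u → Rest v → u ~ v → κ u ≢ κ v
      proper {u} {v} su sv e with R₁? u v
      ... | yes r = proj₁ (proj₂ T.two-colouring) r
      ... | no ¬r = proj₂ (proj₂ T.two-colouring) (su , sv , e , ¬r)

-- Picking one vertex of each triangle and colouring the picks

module Picks (G : Graph) (subcubic : Subcubic G) (saturated : Saturated3 G 2)
  (triangles : ∀ {v} → degree G v ≡ 3 → Neighbourhoods.OnTriangle G v) where
  open Graph G using (n)
  open Structure G subcubic saturated triangles

  -- Class 0: middle vertices of diamonds; 1: other vertices without outer edge; 2 and 3: vertices whose outer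
  -- neighbour has degree less than 3, respectively 3.
  class : ∀ {v} → Dec (HasOuter v) → Dec (deg v ≡ 3) → Fin 4
  class (no _) (yes _) = 0F
  class (no _) (no _) = 1F
  class (yes (w , _)) _ with deg w ℕ.≟ 3
  ... | no _ = 2F
  ... | yes _ = 3F

  abstract
    cls : V → Fin 4
    cls v = class (HasOuter? v) (deg v ℕ.≟ 3)

    cls≡0 : ∀ {v} → ¬ HasOuter v → deg v ≡ 3 → cls v ≡ 0F
    cls≡0 {v} ¬o d with HasOuter? v | deg v ℕ.≟ 3
    ... | yes o | _ = contradiction o ¬o
    ... | no _ | yes _ = refl
    ... | no _ | no ¬d = contradiction d ¬d

    cls≡0⁻ : ∀ {v} → cls v ≡ 0F → ¬ HasOuter v × deg v ≡ 3
    cls≡0⁻ {v} eq with HasOuter? v | deg v ℕ.≟ 3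
    cls≡0⁻ eq | no ¬o | yes d = ¬o , d
    cls≡0⁻ () | no _ | no _
    cls≡0⁻ eq | yes (w , _) | _ with deg w ℕ.≟ 3
    cls≡0⁻ () | yes _ | _ | yes _
    cls≡0⁻ () | yes _ | _ | no _

    2≤cls : ∀ {v} → HasOuter v → 2 ℕ.≤ toℕ (cls v)
    2≤cls {v} o with HasOuter? v
    ... | no ¬o = contradiction o ¬o
    ... | yes (w , _) with deg w ℕ.≟ 3
    ... | no _ = ℕ.s≤s (ℕ.s≤s ℕ.z≤n)
    ... | yes _ = ℕ.s≤s (ℕ.s≤s ℕ.z≤n)

    2≤cls⁻ : ∀ {v} → 2 ℕ.≤ toℕ (cls v) → HasOuter v
    2≤cls⁻ {v} le with HasOuter? v | deg v ℕ.≟ 3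
    2≤cls⁻ le | yes o | _ = o
    2≤cls⁻ () | no _ | yes _
    2≤cls⁻ (ℕ.s≤s ()) | no _ | no _

    cls≡3 : ∀ {v w} → OnTriangle v → Outer v w → deg w ≡ 3 → cls v ≡ 3F
    cls≡3 {v} t o d with HasOuter? v
    ... | no ¬o = contradiction (_ , o) ¬o
    ... | yes (w′ , o′) with deg w′ ℕ.≟ 3
    ... | yes _ = refl
    ... | no ¬d = contradiction (trans (cong deg (outer-unique t o′ o)) d) ¬d

    cls≡3⁻ : ∀ {v w} → OnTriangle v → Outer v w → cls v ≡ 3F → deg w ≡ 3
    cls≡3⁻ {v} t o eq with HasOuter? v
    ... | no ¬o = contradiction (_ , o) ¬o
    ... | yes (w′ , o′) with deg w′ ℕ.≟ 3
    ... | yes d = trans (cong deg (outer-unique t o o′)) d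
    cls≡3⁻ t o () | yes _ | no _

    -- Orders by class and breaks ties by index; the minima within the triangles will be marked.
    π : V → Fin (4 ℕ.* n)
    π v = combine (cls v) v

    π<⇒cls≤ : ∀ {u v} → π u Fin.< π v → cls u Fin.≤ cls v
    π<⇒cls≤ {u} {v} lt = ℕ.≮⇒≥ λ gt → Fin.<-asym lt (Fin.combine-monoˡ-< v u gt)

    π-cmp : ∀ {u v} → u ≢ v → π u Fin.< π v ⊎ π v Fin.< π u
    π-cmp {u} {v} u≢v with Fin.<-cmp (π u) (π v)
    ... | tri< lt _ _ = inj₁ lt
    ... | tri≈ _ eq _ = contradiction (Fin.combine-injectiveʳ (cls u) u (cls v) v eq) u≢v
    ... | tri> _ _ gt = inj₂ gt

  -- The comparison is with all inner neighbours, not within a single triangle. So no triangle has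
  -- two marked vertices, and the work lies in showing that each has one.
  Marked : V → Set
  Marked v = OnTriangle v × (∀ u → v ~ u → CommonNbr v u → π v Fin.< π u)

  Marked? : ∀ v → Dec (Marked v)
  Marked? v = OnTriangle? v ×-dec all? λ u → (v ~? u) →-dec (CommonNbr? v u →-dec (π v Fin.<? π u))

  Marked-one : ∀ {u w} → Marked u → Marked w → Inner u w → ⊥
  Marked-one (_ , mu) (_ , mw) (e , c) = Fin.<-asym (mu _ e c) (mw _ (~-sym e) (CommonNbr-sym c))

  Marked-cls≤ : ∀ {v s} → Marked v → Inner v s → cls v Fin.≤ cls s
  Marked-cls≤ (_ , m) (e , c) = π<⇒cls≤ (m _ e c)

  -- `a` and `b` are the middle of a diamond with ends `c` and `d`, so `a` has class 0. If `d` came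
  -- before `a`, it would have class 0 too; its third edge, being inner, would have to lead to `c`,
  -- giving a K4.
  diamond-≤ : ∀ {a b c d} → a ~ b → a ~ c → b ~ c → a ~ d → d ~ b → d ≢ c → π a Fin.< π d
  diamond-≤ {a} {b} {c} {d} ab ac bc ad db d≢c with π-cmp (~⇒≢ ad)
  ... | inj₁ lt = lt
  ... | inj₂ gt = ⊥-elim (K4-free ab ac ad bc (~-sym db) (~-sym dc))
    where
    b≢c = ~⇒≢ bc
    b≢d = ≢-sym (~⇒≢ db)
    ¬exit : ¬ HasOuter a
    ¬exit (w , aw , ¬c) with third ab ac ad b≢c b≢d (≢-sym d≢c) aw
    ... | inj₁ refl = ¬c (c , ac , bc)
    ... | inj₂ (inj₁ refl) = ¬c (b , ab , ~-sym bc)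
    ... | inj₂ (inj₂ refl) = ¬c (b , ab , db)
    cls-a : cls a ≡ 0F
    cls-a = cls≡0 ¬exit (three⇒deg3 ab ac ad b≢c b≢d (≢-sym d≢c))
    cls-d : cls d ≡ 0F
    cls-d = Fin.toℕ-injective (ℕ.n≤0⇒n≡0 (subst (λ i → cls d Fin.≤ i) cls-a (π<⇒cls≤ gt)))
    dc : d ~ c
    dc with deg3⇒third (proj₂ (cls≡0⁻ cls-d)) a b
    ... | e , de , e≢a , e≢b with ¬HasOuter⇒Inner (proj₁ (cls≡0⁻ cls-d)) de
    ... | _ , f , df , ef with third (~-sym ad) db de (~⇒≢ ab) (≢-sym e≢a) (≢-sym e≢b) df
    ... | inj₂ (inj₂ refl) = contradiction ef ~-irrefl
    ... | inj₁ refl with third ab ac ad b≢c b≢d (≢-sym d≢c) (~-sym ef)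
    ...   | inj₁ e≡b = contradiction e≡b e≢b
    ...   | inj₂ (inj₁ refl) = de
    ...   | inj₂ (inj₂ refl) = contradiction de ~-irrefl
    dc | e , de , e≢a , e≢b | _ , f , df , ef | inj₂ (inj₁ refl)
      with third (~-sym ab) bc (~-sym db) (~⇒≢ ac) (~⇒≢ ad) (≢-sym d≢c) (~-sym ef)
    ...   | inj₁ e≡a = contradiction e≡a e≢a
    ...   | inj₂ (inj₁ refl) = de
    ...   | inj₂ (inj₂ refl) = contradiction de ~-irrefl

  -- An inner neighbour `d` outside the triangle shares `b` or `c` with `a`, so it is an end of a
  -- diamond with `a` in the middle.
  min⇒Marked : ∀ {a b c} → a ~ b → a ~ c → b ~ c → π a Fin.< π b → π a Fin.< π c → Marked a
  min⇒Marked {a} {b} {c} ab ac bc a<b a<c = (b , c , ab , ac , bc) , min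
    where
    min : ∀ d → a ~ d → CommonNbr a d → π a Fin.< π d
    min d ad (e , ae , de) with d ≟ b | d ≟ c
    ... | yes refl | _ = a<b
    ... | no _ | yes refl = a<c
    ... | no d≢b | no d≢c with third ab ac ad (~⇒≢ bc) (≢-sym d≢b) (≢-sym d≢c) ae
    ... | inj₁ refl = diamond-≤ ab ac bc ad de d≢c
    ... | inj₂ (inj₁ refl) = diamond-≤ ac ab (~-sym bc) ad de d≢b
    ... | inj₂ (inj₂ refl) = contradiction de ~-irrefl

  Marked-hit : ∀ {a b c} → a ~ b → a ~ c → b ~ c → Marked a ⊎ Marked b ⊎ Marked c
  Marked-hit ab ac bc with π-cmp (~⇒≢ ab) | π-cmp (~⇒≢ ac) | π-cmp (~⇒≢ bc)
  ... | inj₁ a<b | inj₁ a<c | _ = inj₁ (min⇒Marked ab ac bc a<b a<c)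
  ... | inj₂ b<a | _ | inj₁ b<c = inj₂ (inj₁ (min⇒Marked (~-sym ab) bc ac b<a b<c))
  ... | _ | inj₂ c<a | inj₂ c<b = inj₂ (inj₂ (min⇒Marked (~-sym ac) (~-sym bc) ab c<a c<b))
  ... | inj₁ a<b | inj₂ c<a | inj₁ b<c = contradiction (Fin.<-trans b<c c<a) (Fin.<-asym a<b)
  ... | inj₂ b<a | inj₁ a<c | inj₂ c<b = contradiction (Fin.<-trans c<b b<a) (Fin.<-asym a<c)

  Marked-transversal : IsTransversal Marked
  Marked-transversal = record { dec = Marked? ; hit = Marked-hit ; one = Marked-one }

  private module BM = Bipartite Marked-transversal

  abstract
    κ₀ : V → Bool
    κ₀ = proj₁ BM.two-colouring

    κ₀-proper : ∀ {u v} → OnTriangle u × ¬ Marked u → OnTriangle v × ¬ Marked v → u ~ v → κ₀ u ≢ κ₀ v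
    κ₀-proper = proj₂ BM.two-colouring

  -- The two candidates for the pick in a triangle whose marked vertex has class 2; κ₀ selects one of them.
  Paired : V → Set
  Paired v = ¬ Marked v × ∃[ m ] Marked m × cls m ≡ 2F × Inner v m

  Paired? : ∀ v → Dec (Paired v)
  Paired? v = ¬? (Marked? v) ×-dec any? λ m → Marked? m ×-dec (cls m ≟ 2F) ×-dec (v ~? m) ×-dec CommonNbr? v m

  Paired⇒Rest : ∀ {v} → Paired v → OnTriangle v × ¬ Marked v
  Paired⇒Rest (¬m , _ , _ , _ , i) = Inner⇒OnTriangle i , ¬m

  Paired⇒HasOuter : ∀ {v} → Paired v → HasOuter v
  Paired⇒HasOuter (_ , m , Mm , cls≡2 , i) = 2≤cls⁻ (subst (Fin._≤ cls _) cls≡2 (Marked-cls≤ Mm (Inner-sym i)))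

  Picked : V → Set
  Picked v = (Marked v × cls v ≢ 2F) ⊎ (Paired v × κ₀ v ≡ true)

  Picked? : ∀ v → Dec (Picked v)
  Picked? v = (Marked? v ×-dec ¬? (cls v ≟ 2F)) ⊎-dec (Paired? v ×-dec (κ₀ v Bool.≟ true))

  Picked⇒OnTriangle : ∀ {v} → Picked v → OnTriangle v
  Picked⇒OnTriangle (inj₁ ((t , _) , _)) = t
  Picked⇒OnTriangle (inj₂ (bv , _)) = proj₁ (Paired⇒Rest bv)

  Marked-HasOuter : ∀ {m s} → Marked m → HasOuter m → Inner m s → HasOuter s
  Marked-HasOuter Mm o i = 2≤cls⁻ (ℕ.≤-trans (2≤cls o) (Marked-cls≤ Mm i))

  Paired-triangle : ∀ {v s t} → Paired v → v ~ s → v ~ t → s ~ t → (Marked s × cls s ≡ 2F) ⊎ (Marked t × cls t ≡ 2F)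
  Paired-triangle bv@(_ , m , Mm , cls≡2 , i) vs vt st with inner-nbrs (Paired⇒HasOuter bv) vs vt st i
  ... | inj₁ refl = inj₁ (Mm , cls≡2)
  ... | inj₂ refl = inj₂ (Mm , cls≡2)

  cls2⇒HasOuter : ∀ {m} → cls m ≡ 2F → HasOuter m
  cls2⇒HasOuter {m} eq = 2≤cls⁻ (subst (λ i → 2 ℕ.≤ toℕ i) (sym eq) ℕ.≤-refl)

  -- Vertices without outer edge have the lowest classes and are marked first; hence a pick has an
  -- outer edge only if its whole triangle has.
  Picked-HasOuter : ∀ {v s} → Picked v → HasOuter v → Inner v s → HasOuter s
  Picked-HasOuter (inj₁ (Mv , _)) o i = Marked-HasOuter Mv o i
  Picked-HasOuter (inj₂ (bv , _)) _ (vs , t , vt , st) with Paired-triangle bv vs vt st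
  ... | inj₁ (_ , cls≡2) = cls2⇒HasOuter cls≡2
  ... | inj₂ (Mt , cls≡2) = Marked-HasOuter Mt (cls2⇒HasOuter cls≡2) (~-sym st , _ , ~-sym vt , ~-sym vs)

  Picked-hit′ : ∀ {a b c} → a ~ b → a ~ c → b ~ c → Marked a → Picked a ⊎ Picked b ⊎ Picked c
  Picked-hit′ {a} {b} {c} ab ac bc Ma with cls a ≟ 2F
  ... | no ≢2 = inj₁ (inj₁ (Ma , ≢2))
  -- `b` and `c` are adjacent and unmarked, so `κ₀` takes the value `true` on exactly one of them.
  ... | yes ≡2 with κ₀ b in eb | κ₀ c in ec
  ... | true | _ = inj₂ (inj₁ (inj₂ ((¬Mb , a , Ma , ≡2 , ib) , refl)))
    where
    ib = ~-sym ab , c , bc , ac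
    ¬Mb = λ Mb → Marked-one Mb Ma ib
  ... | false | true = inj₂ (inj₂ (inj₂ ((¬Mc , a , Ma , ≡2 , ic) , refl)))
    where
    ic = ~-sym ac , b , ~-sym bc , ab
    ¬Mc = λ Mc → Marked-one Mc Ma ic
  ... | false | false = contradiction (trans eb (sym ec))
      (κ₀-proper (Inner⇒OnTriangle ib , λ Mb → Marked-one Mb Ma ib)
                 (Inner⇒OnTriangle ic , λ Mc → Marked-one Mc Ma ic) bc)
    where
    ib = ~-sym ab , c , bc , ac
    ic = ~-sym ac , b , ~-sym bc , ab

  Picked-hit : ∀ {a b c} → a ~ b → a ~ c → b ~ c → Picked a ⊎ Picked b ⊎ Picked c
  Picked-hit ab ac bc with Marked-hit ab ac bc
  ... | inj₁ Ma = Picked-hit′ ab ac bc Ma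
  ... | inj₂ (inj₁ Mb) with Picked-hit′ (~-sym ab) bc ac Mb
  ...   | inj₁ x = inj₂ (inj₁ x)
  ...   | inj₂ (inj₁ x) = inj₁ x
  ...   | inj₂ (inj₂ x) = inj₂ (inj₂ x)
  Picked-hit ab ac bc | inj₂ (inj₂ Mc) with Picked-hit′ (~-sym ac) (~-sym bc) ab Mc
  ...   | inj₁ x = inj₂ (inj₂ x)
  ...   | inj₂ (inj₁ x) = inj₁ x
  ...   | inj₂ (inj₂ x) = inj₂ (inj₁ x)

  Paired-one : ∀ {u w} → Paired u → Paired w → u ~ w → κ₀ u ≡ true → κ₀ w ≡ true → ⊥
  Paired-one bu bw e ku kw = κ₀-proper (Paired⇒Rest bu) (Paired⇒Rest bw) e (trans ku (sym kw))

  Marked-Paired-one : ∀ {u w} → Marked u → cls u ≢ 2F → Paired w → Inner u w → ⊥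
  Marked-Paired-one Mu ≢2 bw (uw , t , ut , wt) with Paired-triangle bw (~-sym uw) wt ut
  ... | inj₁ (_ , ≡2) = ≢2 ≡2
  ... | inj₂ (Mt , _) = Marked-one Mu Mt (ut , _ , uw , ~-sym wt)

  Picked-one : ∀ {u w} → Picked u → Picked w → Inner u w → ⊥
  Picked-one (inj₁ (Mu , _)) (inj₁ (Mw , _)) i = Marked-one Mu Mw i
  Picked-one (inj₁ (Mu , ≢2)) (inj₂ (bw , _)) i = Marked-Paired-one Mu ≢2 bw i
  Picked-one (inj₂ (bu , _)) (inj₁ (Mw , ≢2)) i = Marked-Paired-one Mw ≢2 bu (Inner-sym i)
  Picked-one (inj₂ (bu , ku)) (inj₂ (bw , kw)) (e , _) = Paired-one bu bw e ku kw

  Picked-transversal : IsTransversal Picked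
  Picked-transversal = record { dec = Picked? ; hit = Picked-hit ; one = Picked-one }

  -- v lies on a triangle whose three outer neighbours all have degree 3.
  Full : V → Set
  Full v = ∃[ m ] Marked m × cls m ≡ 3F × (m ≡ v ⊎ Inner v m)

  ≥3⇒≡3 : ∀ {i : Fin 4} → 3 ℕ.≤ toℕ i → i ≡ 3F
  ≥3⇒≡3 {3F} _ = refl
  ≥3⇒≡3 {2F} (ℕ.s≤s (ℕ.s≤s ()))
  ≥3⇒≡3 {1F} (ℕ.s≤s ())

  ≥2-≢2⇒≡3 : ∀ {i : Fin 4} → 2 ℕ.≤ toℕ i → i ≢ 2F → i ≡ 3F
  ≥2-≢2⇒≡3 {3F} _ _ = refl
  ≥2-≢2⇒≡3 {2F} _ ≢2 = contradiction refl ≢2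
  ≥2-≢2⇒≡3 {1F} (ℕ.s≤s ())

  Marked-HasOuter⇒3 : ∀ {v} → cls v ≢ 2F → HasOuter v → cls v ≡ 3F
  Marked-HasOuter⇒3 ≢2 o = ≥2-≢2⇒≡3 (2≤cls o) ≢2

  full-triangle : ∀ {v} → Full v → ∃[ b ] ∃[ c ] v ~ b × v ~ c × b ~ c × cls v ≡ 3F × cls b ≡ 3F × cls c ≡ 3F
  full-triangle (m , Mm@((b , c , vb , vc , bc) , _) , ≡3 , inj₁ refl) =
    b , c , vb , vc , bc , ≡3 , up (vb , c , vc , bc) , up (vc , b , vb , ~-sym bc)
    where
    up : ∀ {s} → Inner m s → cls s ≡ 3F
    up i = ≥3⇒≡3 (subst (Fin._≤ cls _) ≡3 (Marked-cls≤ Mm i))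
  full-triangle {v} (m , Mm , ≡3 , inj₂ (vm , t , vt , mt)) =
    m , t , vm , vt , mt , up (~-sym vm , t , mt , vt) , ≡3 , up (mt , v , ~-sym vm , ~-sym vt)
    where
    up : ∀ {s} → Inner m s → cls s ≡ 3F
    up i = ≥3⇒≡3 (subst (Fin._≤ cls _) ≡3 (Marked-cls≤ Mm i))

  HasLow : V → Set
  HasLow v = ∃[ p ] Inner v p × ¬ HasOuter p

  -- `o` lies on a triangle `opq`. If `p` and `q` both had degree 3, then `v` and its neighbours
  -- `b`, `c`, `o` would all be heavy, against saturation. A triangle vertex of smaller degree has
  -- no outer edge.
  full⇒HasLow : ∀ {v o} → Full v → Outer v o → HasLow o
  full⇒HasLow {v} {o} full vo@(v~o , ¬c) with full-triangle full
  ... | b , c , vb , vc , bc , v3 , b3 , c3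
    with 2≤cls⁻ (subst (λ i → 2 ℕ.≤ toℕ i) (sym b3) (ℕ.s≤s (ℕ.s≤s ℕ.z≤n)))
       | 2≤cls⁻ (subst (λ i → 2 ℕ.≤ toℕ i) (sym c3) (ℕ.s≤s (ℕ.s≤s ℕ.z≤n)))
  ... | b′ , bb′ | c′ , cc′ with triangles {o} (cls≡3⁻ (_ , _ , vb , vc , bc) vo v3)
  ... | p , q , op , oq , pq = low (deg p ℕ.≟ 3) (deg q ℕ.≟ 3)
    where
    tri-b = v , c , ~-sym vb , bc , vc
    tri-c = v , b , ~-sym vc , ~-sym bc , vb
    b≢c = ~⇒≢ bc
    v≢b = ~⇒≢ vb
    v≢c = ~⇒≢ vc
    b≢o = outer-≢ vo (c , vc , bc)
    c≢o = outer-≢ vo (b , vb , ~-sym bc)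
    v≢b′ = outer-≢ bb′ (c , bc , vc)
    c≢b′ = outer-≢ bb′ (v , ~-sym vb , ~-sym vc)
    v≢c′ = outer-≢ cc′ (b , ~-sym bc , vb)
    b≢c′ = outer-≢ cc′ (v , ~-sym vc , ~-sym vb)
    dv = three⇒deg3 vb vc v~o b≢c b≢o c≢o
    db = hasO⇒deg3 tri-b (b′ , bb′)
    dc = hasO⇒deg3 tri-c (c′ , cc′)
    do′ = cls≡3⁻ (_ , _ , vb , vc , bc) vo v3
    v≢p : v ≢ p
    v≢p refl = ¬c (q , pq , oq)
    v≢q : v ≢ q
    v≢q refl = ¬c (p , ~-sym pq , op)
    low : Dec (deg p ≡ 3) → Dec (deg q ≡ 3) → HasLow o
    low (no ¬dp) _ = p , (op , q , oq , pq) , λ e → ¬dp (hasO⇒deg3 (o , q , ~-sym op , pq , oq) e)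
    low (yes _) (no ¬dq) = q , (oq , p , op , ~-sym pq) , λ e → ¬dq (hasO⇒deg3 (o , p , ~-sym oq , ~-sym pq , op) e)
    low (yes dp) (yes dq) = ⊥-elim (¬three-heavy
      (heavy vb vc v~o b≢c b≢o c≢o db dc do′) vb vc v~o b≢c b≢o c≢o
      (heavy (~-sym vb) bc (proj₁ bb′) v≢c v≢b′ c≢b′ dv dc (cls≡3⁻ tri-b bb′ b3))
      (heavy (~-sym vc) (~-sym bc) (proj₁ cc′) v≢b v≢c′ b≢c′ dv db (cls≡3⁻ tri-c cc′ c3))
      (heavy (~-sym v~o) op oq v≢p v≢q (~⇒≢ pq) dv dp dq))

  Picked-¬HasLow : ∀ {v} → Picked v → HasOuter v → ¬ HasLow v
  Picked-¬HasLow x o (p , i , ¬o) = ¬o (Picked-HasOuter x o i)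

  -- Inner edges are excluded by the transversal property. Across an outer edge, a marked pick has
  -- class 3 and forces an inner neighbour without outer edge on the other pick, against
  -- `Picked-HasOuter`; two paired picks have the same value under the proper colouring `κ₀`.
  Picked-independent : ∀ {u w} → Picked u → Picked w → ¬ u ~ w
  Picked-independent {u} {w} xu xw e with CommonNbr? u w
  ... | yes c = Picked-one xu xw (e , c)
  ... | no ¬c = outer xu xw (e , ¬c)
    where
    outer : ∀ {u w} → Picked u → Picked w → Outer u w → ⊥
    outer (inj₁ (Mu , ≢2)) xw o =
      Picked-¬HasLow xw (_ , Outer-sym o) (full⇒HasLow (_ , Mu , Marked-HasOuter⇒3 ≢2 (_ , o) , inj₁ refl) o)
    outer xu (inj₁ (Mw , ≢2)) o =
      Picked-¬HasLow xu (_ , o)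
        (full⇒HasLow (_ , Mw , Marked-HasOuter⇒3 ≢2 (_ , Outer-sym o) , inj₁ refl) (Outer-sym o))
    outer (inj₂ (bu , ku)) (inj₂ (bw , kw)) o = Paired-one bu bw (proj₁ o) ku kw

  -- Two different picks next to `a′`, together with `a`, give `a′` degree 3 and so a triangle. It
  -- avoids `a` because the edge is outer, hence it joins the two picks, which are independent.
  branch : ∀ {a a′ u w} → Outer a a′ → Picked u → Picked w → u ≢ a → w ≢ a → Within 1 a′ u → Within 1 a′ w → u ≡ w
  branch _ xu xw _ _ (inj₁ refl) (inj₁ refl) = refl
  branch _ xu xw _ _ (inj₁ refl) (inj₂ (w , e , refl)) = contradiction e (Picked-independent xu xw)
  branch _ xu xw _ _ (inj₂ (u , e , refl)) (inj₁ refl) = contradiction (~-sym e) (Picked-independent xu xw)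
  branch {a} {a′} {u} {w} (aa′ , ¬c) xu xw u≢a w≢a (inj₂ (u , e , refl)) (inj₂ (w , e′ , refl)) with u ≟ w
  ... | yes p = p
  ... | no u≢w with triangles {a′} (three⇒deg3 e e′ (~-sym aa′) u≢w u≢a w≢a)
  ... | p , q , a′p , a′q , pq = ⊥-elim (Picked-independent xu xw
      (adjacent (other a′p (λ { refl → ¬c (q , pq , a′q) })) (other a′q (λ { refl → ¬c (p , ~-sym pq , a′p) }))))
    where
    other : ∀ {p} → a′ ~ p → p ≢ a → p ≡ u ⊎ p ≡ w
    other a′p p≢a with third e e′ (~-sym aa′) u≢w u≢a w≢a a′p
    ... | inj₁ p≡u = inj₁ p≡u
    ... | inj₂ (inj₁ p≡w) = inj₂ p≡w
    ... | inj₂ (inj₂ p≡a) = contradiction p≡a p≢a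
    adjacent : p ≡ u ⊎ p ≡ w → q ≡ u ⊎ q ≡ w → u ~ w
    adjacent (inj₁ refl) (inj₂ refl) = pq
    adjacent (inj₂ refl) (inj₁ refl) = ~-sym pq
    adjacent (inj₁ refl) (inj₁ refl) = contradiction pq ~-irrefl
    adjacent (inj₂ refl) (inj₂ refl) = contradiction pq ~-irrefl

  -- Conflicts between picks with an outer edge

  High : V → Set
  High v = Picked v × HasOuter v

  -- The conflicts of v that run through its outer edge.
  Towards : V → V → Set
  Towards v u = High v × High u × u ≢ v × ∃[ v′ ] Outer v v′ × Within 2 v′ u

  Towards? : ∀ v u → Dec (Towards v u)
  Towards? v u = High? v ×-dec High? u ×-dec ¬? (u ≟ v) ×-dec
    any? λ v′ → ((v ~? v′) ×-dec ¬? (CommonNbr? v v′)) ×-dec Within? 2 v′ u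
    where
    High? : ∀ v → Dec (High v)
    High? v = Picked? v ×-dec HasOuter? v

  -- If `v′` is off all triangles, it has at most one neighbour besides `v`, and `branch` applies
  -- there. Otherwise its triangle contains a pick `p`, and every conflict is `p` or a neighbour of
  -- the third vertex `q`.
  Towards-functional : ∀ {v u w} → Towards v u → Towards v w → u ≡ w
  Towards-functional {v} {u₁} {w₁} ((xv , ov) , hu₁ , u₁≢v , v′ , vv′ , du₁) (_ , hw₁ , w₁≢v , v″ , vv″ , dw₁)
    with refl ← outer-unique (Picked⇒OnTriangle xv) vv″ vv′ = result
    where
    v′v = ~-sym (proj₁ vv′)
    dv : deg v ≡ 3
    dv = hasO⇒deg3 (Picked⇒OnTriangle xv) ov

    Picked≢v′ : ∀ {u} → Picked u → u ≢ v′
    Picked≢v′ xu refl = Picked-independent xv xu (proj₁ vv′)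

    detour : ∀ {u} → Picked u → u ≢ v → Within 2 v′ u → ∃[ s ] v′ ~ s × s ≢ v × Within 1 s u
    detour xu u≢v (inj₁ refl) = contradiction refl (Picked≢v′ xu)
    detour xu u≢v (inj₂ (s , v′s , d)) = s , v′s , s≢v d , d
      where
      s≢v : Within 1 s _ → s ≢ v
      s≢v (inj₁ refl) = u≢v
      s≢v (inj₂ (_ , su , refl)) refl = Picked-independent xv xu su

    module TriangleBeyond {p q} (v′p : v′ ~ p) (v′q : v′ ~ q) (pq : p ~ q) (xp : Picked p) where
      v≢p : v ≢ p
      v≢p refl = proj₂ vv′ (q , pq , v′q)
      v≢q : v ≢ q
      v≢q refl = proj₂ vv′ (p , ~-sym pq , v′p)

      ¬Xq : ¬ Picked q
      ¬Xq xq = Picked-independent xp xq pq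

      split : ∀ {u} → Picked u → u ≢ v → Within 2 v′ u → u ≡ p ⊎ (q ~ u × u ≢ p)
      split {u} xu u≢v d with u ≟ p
      ... | yes u≡p = inj₁ u≡p
      ... | no u≢p with detour xu u≢v d
      ... | s , v′s , s≢v , d′ with third v′v v′p v′q v≢p v≢q (~⇒≢ pq) v′s | d′
      ... | inj₁ s≡v | _ = contradiction s≡v s≢v
      ... | inj₂ (inj₁ refl) | inj₁ p≡u = contradiction (sym p≡u) u≢p
      ... | inj₂ (inj₁ refl) | inj₂ (_ , pu , refl) = contradiction pu (Picked-independent xp xu)
      ... | inj₂ (inj₂ refl) | inj₁ refl = contradiction xu ¬Xq
      ... | inj₂ (inj₂ refl) | inj₂ (_ , qu , refl) = inj₂ (qu , u≢p)

      tri-v′ : OnTriangle v′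
      tri-v′ = p , q , v′p , v′q , pq

      -- A marked pick `p` would have class 3, and `v` would get an inner neighbour without outer
      -- edge. If `p` is paired, `v′` or `q` has class 2, but their outer neighbours `v` and `u`
      -- have degree 3.
      forced : HasOuter p → ∀ {u} → High u → q ~ u → u ≢ p → ⊥
      forced op {u} (xu , ou) qu u≢p = go xp
        where
        u≢v′ = Picked≢v′ xu
        go : Picked p → ⊥
        go (inj₁ (Mp , ≢2)) = Picked-¬HasLow xv ov
          (full⇒HasLow (p , Mp , Marked-HasOuter⇒3 ≢2 op , inj₂ (v′p , q , v′q , pq)) (Outer-sym vv′))
        go (inj₂ (bp , _)) with Paired-triangle bp (~-sym v′p) pq v′q
        ... | inj₁ (_ , ≡2) with () ← trans (sym ≡2) (cls≡3 tri-v′ (Outer-sym vv′) dv)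
        ... | inj₂ (Mq , ≡2) with CommonNbr? q u
        ... | yes c = [ u≢v′ , u≢p ]′ (inner-nbrs (cls2⇒HasOuter ≡2) (~-sym v′q) (~-sym pq) v′p (qu , c))
        ... | no ¬c with () ← trans (sym ≡2) (cls≡3 (proj₁ Mq) (qu , ¬c) (hasO⇒deg3 (Picked⇒OnTriangle xu) ou))

      unique : ∀ {u w} → High u → High w → u ≢ v → w ≢ v → Within 2 v′ u → Within 2 v′ w → u ≡ w
      unique hu@(xu , ou) hw@(xw , ow) u≢v w≢v du dw with HasOuter? p | split xu u≢v du | split xw w≢v dw
      ... | _ | inj₁ refl | inj₁ refl = refl
      ... | yes op | inj₂ (qu , u≢p) | _ = ⊥-elim (forced op hu qu u≢p)
      ... | yes op | _ | inj₂ (qw , w≢p) = ⊥-elim (forced op hw qw w≢p)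
      -- Without an outer edge `p` is not `High`; what remains is the third neighbour of `q`.
      ... | no ¬op | inj₁ refl | _ = contradiction ou ¬op
      ... | no ¬op | _ | inj₁ refl = contradiction ow ¬op
      ... | no ¬op | inj₂ (qu , u≢p) | inj₂ (qw , w≢p) =
        third-unique (~-sym pq) (~-sym v′q) (≢-sym (~⇒≢ v′p)) qu u≢p (Picked≢v′ xu) qw w≢p (Picked≢v′ xw)

    result : u₁ ≡ w₁
    result with OnTriangle? v′
    ... | yes (p , q , v′p , v′q , pq) with Picked-hit v′p v′q pq
    ...   | inj₁ xv′ = contradiction refl (Picked≢v′ xv′)
    ...   | inj₂ (inj₁ xp) = TriangleBeyond.unique v′p v′q pq xp hu₁ hw₁ u₁≢v w₁≢v du₁ dw₁
    ...   | inj₂ (inj₂ xq) = TriangleBeyond.unique v′q v′p (~-sym pq) xq hu₁ hw₁ u₁≢v w₁≢v du₁ dw₁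
    result | no ¬tri with detour (proj₁ hu₁) u₁≢v du₁ | detour (proj₁ hw₁) w₁≢v dw₁
    ... | s , v′s , s≢v , d | t , v′t , t≢v , d′ with s ≟ t
    ... | no s≢t = contradiction (triangles (three⇒deg3 v′v v′s v′t (≢-sym s≢v) (≢-sym t≢v) s≢t)) ¬tri
    ... | yes refl = branch (v′s , λ (r , v′r , sr) → ¬tri (_ , _ , v′s , v′r , sr)) (proj₁ hu₁) (proj₁ hw₁)
                       (Picked≢v′ (proj₁ hu₁)) (Picked≢v′ (proj₁ hw₁)) d d′

  -- The outer neighbour of degree 3 gives `s` class 3, so `s` is not the marked vertex of class 2,
  -- and `κ₀` separates it from `v`.
  Paired-false : ∀ {v s t} → Paired v → κ₀ v ≡ true → Inner v s → Outer s t → deg t ≡ 3 →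
    (OnTriangle s × ¬ Marked s) × κ₀ s ≡ false
  Paired-false {v} {s} {t} bv kv i@(vs , r , vr , sr) o d = Rest-s , κ₀≡false
    where
    ¬Ms : ¬ Marked s
    ¬Ms Ms with Paired-triangle bv vs vr sr
    ... | inj₁ (_ , ≡2) with () ← trans (sym ≡2) (cls≡3 (proj₁ Ms) o d)
    ... | inj₂ (Mr , _) = Marked-one Ms Mr (sr , v , ~-sym vs , ~-sym vr)
    Rest-s = Inner⇒OnTriangle (Inner-sym i) , ¬Ms
    κ₀≡false : κ₀ s ≡ false
    κ₀≡false with κ₀ s in eq
    ... | false = refl
    ... | true = contradiction (trans eq (sym kv)) (κ₀-proper Rest-s (Paired⇒Rest bv) (~-sym vs))

  far-Marked : ∀ {v u s t} → Marked v → cls v ≢ 2F → HasOuter v → High u → Inner v s → Inner u t → Outer s t → ⊥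
  far-Marked {v} {u} {s} {t} Mv ≢2 ov (xu , ou) vs (ut , r , ur , tr) o
    with full⇒HasLow (v , Mv , Marked-HasOuter⇒3 ≢2 ov , inj₂ (Inner-sym vs)) o
  ... | p , tp , ¬op with inner-nbrs (s , Outer-sym o) (~-sym ut) tr ur tp
  ... | inj₁ refl = ¬op ou
  ... | inj₂ refl = ¬op (Picked-HasOuter xu ou (ur , t , ut , ~-sym tr))

  -- If one end is a marked pick, its triangle is full and the other triangle would have a vertex
  -- without outer edge. If both are paired, the adjacent vertices `s` and `t` would both be `false`
  -- under `κ₀`.
  far : ∀ {v u s t} → High v → High u → Inner v s → Inner u t → Outer s t → ⊥
  far (inj₁ (Mv , ≢2) , ov) hu vs ut o = far-Marked Mv ≢2 ov hu vs ut o
  far hv (inj₁ (Mu , ≢2) , ou) vs ut o = far-Marked Mu ≢2 ou hv ut vs (Outer-sym o)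
  far (inj₂ (bv , kv) , _) (inj₂ (bu , ku) , _) vs ut o
    with Paired-false bv kv vs o (hasO⇒deg3 (Inner⇒OnTriangle (Inner-sym ut)) (_ , Outer-sym o))
       | Paired-false bu ku ut (Outer-sym o) (hasO⇒deg3 (Inner⇒OnTriangle (Inner-sym vs)) (_ , o))
  ... | Rest-s , ks | Rest-t , kt = κ₀-proper Rest-s Rest-t (proj₁ o) (trans ks (sym kt))

  -- If the first or last edge of the path is outer, the conflict runs through it. Otherwise `far`
  -- forbids an outer middle edge, and a path of inner edges would stay in one triangle, which has a
  -- single pick.
  high-conflict : ∀ {v u} → High v → High u → u ≢ v → Within 3 v u → Towards v u ⊎ Towards u v
  high-conflict _ _ u≢v (inj₁ v≡u) = contradiction (sym v≡u) u≢v
  high-conflict {v} {u} hv@(xv , ov) hu@(xu , ou) u≢v (inj₂ (s , vs , d)) with CommonNbr? v s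
  ... | no ¬c = inj₁ (hv , hu , u≢v , s , (vs , ¬c) , d)
  ... | yes vs-c@(r , vr , sr) = via d
    where
    ¬vu = Picked-independent xv xu
    os = Picked-HasOuter xv ov (vs , vs-c)
    via : Within 2 s u → Towards v u ⊎ Towards u v
    via (inj₁ refl) = contradiction vs ¬vu
    via (inj₂ (t , st , inj₁ refl)) with CommonNbr? s t
    ... | no ¬c = inj₂ (hu , hv , ≢-sym u≢v , s , Outer-sym (st , ¬c) , inj₂ (v , ~-sym vs , inj₁ refl))
    ... | yes c with inner-nbrs os (~-sym vs) sr vr (st , c)
    ...   | inj₁ u≡v = contradiction u≡v u≢v
    ...   | inj₂ refl = contradiction vr ¬vu
    via (inj₂ (t , st , inj₂ (_ , tu , refl))) with CommonNbr? u t
    ... | no ¬c = inj₂ (hu , hv , ≢-sym u≢v , t , (~-sym tu , ¬c) , inj₂ (s , ~-sym st , inj₂ (v , ~-sym vs , refl)))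
    ... | yes ut-c with CommonNbr? s t
    ...   | no ¬c = ⊥-elim (far hv hu (vs , vs-c) (~-sym tu , ut-c) (st , ¬c))
    ...   | yes c with inner-nbrs os (~-sym vs) sr vr (st , c)
    ...     | inj₁ refl = contradiction tu ¬vu
    ...     | inj₂ refl with inner-nbrs (Picked-HasOuter xu ou (~-sym tu , ut-c)) (~-sym sr) (~-sym vr) (~-sym vs)
                                        (tu , CommonNbr-sym ut-c)
    ...       | inj₁ refl = contradiction vs ¬vu
    ...       | inj₂ u≡v = contradiction u≡v u≢v

  -- Conflicts of picks without an outer edge

  low⇒Marked : ∀ {v} → Picked v → ¬ HasOuter v → Marked v
  low⇒Marked (inj₁ (Mv , _)) _ = Mv
  low⇒Marked (inj₂ (bv , _)) ¬o = contradiction (Paired⇒HasOuter bv) ¬o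

  -- Unless `t` is seen to be adjacent to `v` at once, `s` and `r` are the middle of a diamond with
  -- ends `v` and `t`. Then `s` has class 0, hence so has the marked `v`, whose third edge is inner
  -- and can only lead to `t`.
  low-inner : ∀ {v s t} → Marked v → ¬ HasOuter v → Inner v s → Inner s t → t ≢ v → v ~ t
  low-inner {v} {s} {t} Mv ¬ov vs@(v~s , r , vr , sr) (st , w , sw , tw) t≢v with t ≟ r
  ... | yes refl = vr
  ... | no t≢r = go (third sv sr st (~⇒≢ vr) (≢-sym t≢v) (≢-sym t≢r) sw)
    where
    sv = ~-sym v~s
    middle : r ~ t → v ~ t
    middle rt = spare (deg3⇒third (proj₂ (cls≡0⁻ v0)) s r)
      where
      ¬os : ¬ HasOuter s
      ¬os (x , sx , ¬c) with third sv sr st (~⇒≢ vr) (≢-sym t≢v) (≢-sym t≢r) sx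
      ... | inj₁ refl = ¬c (r , sr , vr)
      ... | inj₂ (inj₁ refl) = ¬c (v , sv , ~-sym vr)
      ... | inj₂ (inj₂ refl) = ¬c (r , sr , ~-sym rt)
      s0 : cls s ≡ 0F
      s0 = cls≡0 ¬os (three⇒deg3 sv sr st (~⇒≢ vr) (≢-sym t≢v) (≢-sym t≢r))
      v0 : cls v ≡ 0F
      v0 = Fin.toℕ-injective (ℕ.n≤0⇒n≡0 (subst (λ i → cls v Fin.≤ i) s0 (Marked-cls≤ Mv vs)))
      spare : ∃[ e ] v ~ e × e ≢ s × e ≢ r → v ~ t
      spare (e , ve , e≢s , e≢r) with ¬HasOuter⇒Inner ¬ov ve
      ... | _ , f , vf , ef with third v~s vr ve (~⇒≢ sr) (≢-sym e≢s) (≢-sym e≢r) vf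
      ... | inj₂ (inj₂ refl) = contradiction ef ~-irrefl
      ... | inj₁ refl = subst (v ~_) (third-unique sv sr (~⇒≢ vr) (~-sym ef) (≢-sym (~⇒≢ ve)) e≢r st t≢v t≢r) ve
      ... | inj₂ (inj₁ refl) = subst (v ~_)
        (third-unique (~-sym vr) (~-sym sr) (~⇒≢ v~s) (~-sym ef) (≢-sym (~⇒≢ ve)) e≢s rt t≢v (≢-sym (~⇒≢ st))) ve
    go : w ≡ v ⊎ w ≡ r ⊎ w ≡ t → v ~ t
    go (inj₁ refl) = ~-sym tw
    go (inj₂ (inj₁ refl)) = middle (~-sym tw)
    go (inj₂ (inj₂ refl)) = contradiction tw ~-irrefl

  Side : V → V → V → Set
  Side v u s = v ~ s × ∃[ s′ ] Outer s s′ × Within 1 s′ u × u ≢ s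

  -- By `low-inner`, inner edges lead from `v` only to its neighbours, which are not picked; so the
  -- path must take an outer edge at one of them.
  low-conflict : ∀ {v u} → Picked v → ¬ HasOuter v → Picked u → u ≢ v → Within 3 v u → ∃ (Side v u)
  low-conflict _ _ _ u≢v (inj₁ v≡u) = contradiction (sym v≡u) u≢v
  low-conflict {v} {u} xv ¬ov xu u≢v (inj₂ (s , vs , d)) = via d
    where
    ¬vu = Picked-independent xv xu
    Mv = low⇒Marked xv ¬ov
    last : ∀ {s} → v ~ s → s ~ u → Outer s u
    last {s} vs su with CommonNbr? s u
    ... | no ¬c = su , ¬c
    ... | yes c = contradiction (low-inner Mv ¬ov (¬HasOuter⇒Inner ¬ov vs) (su , c) u≢v) ¬vu
    via : Within 2 s u → ∃ (Side v u)
    via (inj₁ refl) = contradiction vs ¬vu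
    via (inj₂ (t , st , inj₁ refl)) = s , vs , t , last vs st , inj₁ refl , ≢-sym (~⇒≢ st)
    via (inj₂ (t , st , inj₂ (_ , tu , refl))) with CommonNbr? s t
    ... | no ¬c = s , vs , t , (st , ¬c) , inj₂ (u , tu , refl) , λ { refl → ¬vu vs }
    ... | yes c with t ≟ v
    ...   | yes refl = contradiction tu ¬vu
    ...   | no t≢v = t , vt , u , last vt tu , inj₁ refl , ≢-sym (~⇒≢ tu)
      where vt = low-inner Mv ¬ov (¬HasOuter⇒Inner ¬ov vs) (st , c) t≢v

  side-injective : ∀ {v u w s t} → Picked u → Picked w → Side v u s → Side v w t → OnTriangle s → u ≢ w → s ≢ t
  side-injective xu xw (vs , s′ , o , d , u≢s) (_ , t′ , o′ , d′ , w≢s) tri u≢w refl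
    with refl ← outer-unique tri o′ o = u≢w (branch o xu xw u≢s w≢s d d′)

  -- No edge at `v` is outer, so each of the three neighbours is adjacent to another of them. One is
  -- then adjacent to both others, and all its edges are inner.
  ¬three-exits : ∀ {v a b c} → ¬ HasOuter v → v ~ a → v ~ b → v ~ c → a ≢ b → a ≢ c → b ≢ c →
    HasOuter a → HasOuter b → HasOuter c → ⊥
  ¬three-exits {v} {a} {b} {c} ¬o va vb vc a≢b a≢c b≢c oa ob oc =
    go (mate va vb vc a≢b a≢c b≢c) (mate vb va vc (≢-sym a≢b) b≢c a≢c) (mate vc va vb (≢-sym a≢c) (≢-sym b≢c) a≢b)
    where
    mate : ∀ {a b c} → v ~ a → v ~ b → v ~ c → a ≢ b → a ≢ c → b ≢ c → a ~ b ⊎ a ~ c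
    mate va vb vc a≢b a≢c b≢c with ¬HasOuter⇒Inner ¬o va
    ... | _ , w , vw , aw with third va vb vc a≢b a≢c b≢c vw
    ... | inj₁ refl = contradiction aw ~-irrefl
    ... | inj₂ (inj₁ refl) = inj₁ aw
    ... | inj₂ (inj₂ refl) = inj₂ aw
    full : ∀ {a b c} → v ~ a → v ~ b → v ~ c → b ≢ c → a ~ b → a ~ c → HasOuter a → ⊥
    full va vb vc b≢c ab ac (o , ao , ¬c) with third (~-sym va) ab ac (~⇒≢ vb) (~⇒≢ vc) b≢c ao
    ... | inj₁ refl = ¬c (_ , ab , vb)
    ... | inj₂ (inj₁ refl) = ¬c (_ , ~-sym va , ~-sym vb)
    ... | inj₂ (inj₂ refl) = ¬c (_ , ~-sym va , ~-sym vc)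
    go : a ~ b ⊎ a ~ c → b ~ a ⊎ b ~ c → c ~ a ⊎ c ~ b → ⊥
    go (inj₁ ab) _ (inj₁ ca) = full va vb vc b≢c ab (~-sym ca) oa
    go (inj₁ ab) _ (inj₂ cb) = full vb va vc a≢c (~-sym ab) (~-sym cb) ob
    go (inj₂ ac) (inj₁ ba) _ = full va vb vc b≢c (~-sym ba) ac oa
    go (inj₂ ac) (inj₂ bc) _ = full vc va vb a≢b (~-sym ac) (~-sym bc) oc

  Conflict : V → V → Set
  Conflict u v = Picked u × Picked v × u ≢ v × Within 3 u v

  low-conflicts : ∀ v → ¬ High v → AtMostTwo (Conflict v)
  low-conflicts v ¬hv (xv , x₁ , ≢₁ , d₁) (_ , x₂ , ≢₂ , d₂) (_ , x₃ , ≢₃ , d₃) 1≢2 1≢3 2≢3 =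
    ¬three-exits ¬o (proj₁ side₁) (proj₁ side₂) (proj₁ side₃)
      (side-injective x₁ x₂ side₁ side₂ (tri side₁) 1≢2)
      (side-injective x₁ x₃ side₁ side₃ (tri side₁) 1≢3)
      (side-injective x₂ x₃ side₂ side₃ (tri side₂) 2≢3)
      (exit side₁) (exit side₂) (exit side₃)
    where
    ¬o : ¬ HasOuter v
    ¬o o = ¬hv (xv , o)
    side₁ = proj₂ (low-conflict xv ¬o x₁ (≢-sym ≢₁) d₁)
    side₂ = proj₂ (low-conflict xv ¬o x₂ (≢-sym ≢₂) d₂)
    side₃ = proj₂ (low-conflict xv ¬o x₃ (≢-sym ≢₃) d₃)
    exit : ∀ {u s} → Side v u s → HasOuter s
    exit (_ , s′ , o , _) = s′ , o
    tri : ∀ {u s} → Side v u s → OnTriangle s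
    tri (vs , _) = Inner⇒OnTriangle (Inner-sym (¬HasOuter⇒Inner ¬o vs))

  three-colouring : Σ (V → Fin 3) λ c → ∀ {u v} → Conflict u v → c u ≢ c v
  three-colouring = Greedy.colouring
    (λ u v → Picked? u ×-dec Picked? v ×-dec ¬? (u ≟ v) ×-dec Within? 3 u v)
    (λ (xu , xv , u≢v , d) → xv , xu , ≢-sym u≢v , Within-sym 3 d)
    (λ (_ , _ , u≢u , _) → u≢u refl)
    (λ u → Picked? u ×-dec HasOuter? u)
    c₀ c₀-proper low-conflicts
    where
    -- A vertex without conflict through its outer edge is sent to itself, which imposes no
    -- constraint.
    out : ∀ v → Dec (∃ (Towards v)) → V
    out _ (yes (u , _)) = u
    out v (no _) = v
    f : V → V
    f v = out v (any? (Towards? v))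
    c₀ = proj₁ (functional-graph-3-colourable f)
    f≡ : ∀ {v u} → Towards v u → f v ≡ u
    f≡ {v} o with any? (Towards? v)
    ... | yes (_ , o′) = Towards-functional o′ o
    ... | no ¬o = contradiction (_ , o) ¬o
    c₀-Towards : ∀ {v u} → Towards v u → c₀ v ≢ c₀ u
    c₀-Towards {v} o@(_ , _ , u≢v , _) eq = proj₂ (functional-graph-3-colourable f) v
      (λ fv≡v → u≢v (trans (sym (f≡ o)) fv≡v)) (trans eq (cong c₀ (sym (f≡ o))))
    c₀-proper : ∀ {u v} → Conflict u v → High u → High v → c₀ u ≢ c₀ v
    c₀-proper (_ , _ , u≢v , d) hu hv with high-conflict hu hv (≢-sym u≢v) d
    ... | inj₁ o = c₀-Towards o
    ... | inj₂ o = c₀-Towards o ∘ sym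

-- Inserting the vertices off the triangles

module Insertion (G : Graph) (subcubic : Subcubic G) (saturated : Saturated3 G 2)
  (triangles : ∀ {v} → degree G v ≡ 3 → Neighbourhoods.OnTriangle G v) where
  open Graph G using (n)
  open Structure G subcubic saturated triangles
  open Picks G subcubic saturated triangles
  open DecMembership (_≟_ {n}) using (_∈?_)
  private module BX = Bipartite Picked-transversal

  Done : List V → V → Set
  Done xs u = OnTriangle u ⊎ u ∈ xs

  Big : List V → V → Set
  Big zs u = Picked u ⊎ u ∈ zs

  Small : List V → List V → V → Set
  Small xs zs u = Done xs u × ¬ Big zs u

  Done? : ∀ xs u → Dec (Done xs u)
  Done? xs u = OnTriangle? u ⊎-dec (u ∈? xs)

  Big? : ∀ zs u → Dec (Big zs u)
  Big? zs u = Picked? u ⊎-dec (u ∈? zs)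

  Small? : ∀ xs zs u → Dec (Small xs zs u)
  Small? xs zs u = Done? xs u ×-dec ¬? (Big? zs u)

  -- zs are the vertices off the triangles that received a colour of radius 3.
  record State (xs : List V) : Set where
    field
      zs       : List V
      κ        : V → Bool
      c        : V → Fin 3
      zs-free  : ∀ {z} → z ∈ zs → ¬ OnTriangle z × z ∈ xs × (∀ {w} → z ~ w → Small xs zs w)
      κ-proper : ∀ {u v} → Small xs zs u → Small xs zs v → u ~ v → κ u ≢ κ v
      c-proper : ∀ {u v} → Big zs u → Big zs v → u ≢ v → Within 3 u v → c u ≢ c v

  initial : State []
  initial = record
    { zs = [] ; κ = proj₁ BX.two-colouring ; c = proj₁ three-colouring
    ; zs-free = λ ()
    ; κ-proper = λ su sv → proj₂ BX.two-colouring (unpicked su) (unpicked sv)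
    ; c-proper = λ { (inj₁ xu) (inj₁ xv) u≢v d → proj₂ three-colouring (xu , xv , u≢v , d)
                   ; (inj₂ ()) _ ; _ (inj₂ ()) } }
    where
    unpicked : ∀ {u} → Small [] [] u → OnTriangle u × ¬ Picked u
    unpicked (inj₁ t , ¬big) = t , ¬big ∘ inj₁
    unpicked (inj₂ () , _)

  update : ∀ {A : Set} → V → A → (V → A) → V → A
  update x a f u with x ≟ u
  ... | yes _ = a
  ... | no _ = f u

  module Insert {xs} (state : State xs) {z} (z∉ : ¬ Done xs z) where
    open State state

    ¬OnTriangle-z : ¬ OnTriangle z
    ¬OnTriangle-z = z∉ ∘ inj₁

    big⇒done : ∀ {u} → Big zs u → Done xs u
    big⇒done (inj₁ xu) = inj₁ (Picked⇒OnTriangle xu)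
    big⇒done (inj₂ u∈) = inj₂ (proj₁ (proj₂ (zs-free u∈)))

    done-≢z : ∀ {u} → Done xs u → z ≢ u
    done-≢z d refl = z∉ d

    weaken : ∀ {u} → Done xs u → Done (z ∷ xs) u
    weaken (inj₁ t) = inj₁ t
    weaken (inj₂ u∈) = inj₂ (there u∈)

    strengthen : ∀ {u} → z ≢ u → Done (z ∷ xs) u → Done xs u
    strengthen _ (inj₁ t) = inj₁ t
    strengthen z≢u (inj₂ (here refl)) = contradiction refl z≢u
    strengthen _ (inj₂ (there u∈)) = inj₂ u∈

    insert-small : (κ′ : V → Bool) → (∀ {u v} → Small xs zs u → Small xs zs v → u ~ v → κ′ u ≢ κ′ v) →
      ∀ b → (∀ {w} → Small xs zs w → z ~ w → b ≢ κ′ w) → State (z ∷ xs)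
    insert-small κ′ proper b differs = record
      { zs = zs ; κ = update z b κ′ ; c = c
      ; zs-free = λ u∈ → let (¬t , u∈xs , nbrs) = zs-free u∈
                         in ¬t , there u∈xs , λ e → weaken (proj₁ (nbrs e)) , proj₂ (nbrs e)
      ; κ-proper = proper′
      ; c-proper = c-proper }
      where
      proper′ : ∀ {u v} → Small (z ∷ xs) zs u → Small (z ∷ xs) zs v → u ~ v → update z b κ′ u ≢ update z b κ′ v
      proper′ {u} {v} (du , bu) (dv , bv) e with z ≟ u | z ≟ v
      ... | yes refl | yes refl = contradiction e ~-irrefl
      ... | yes refl | no z≢v = differs (strengthen z≢v dv , bv) e
      ... | no z≢u | yes refl = ≢-sym (differs (strengthen z≢u du , bu) (~-sym e))
      ... | no z≢u | no z≢v = proper (strengthen z≢u du , bu) (strengthen z≢v dv , bv) e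

    two-nbrs : ∀ {y₁ y₂ w} → z ~ y₁ → z ~ y₂ → y₁ ≢ y₂ → z ~ w → w ≡ y₁ ⊎ w ≡ y₂
    two-nbrs {y₁} {y₂} {w} zy₁ zy₂ y₁≢y₂ zw with w ≟ y₁ | w ≟ y₂
    ... | yes p | _ = inj₁ p
    ... | no _ | yes p = inj₂ p
    ... | no p | no q = contradiction (triangles (three⇒deg3 zy₁ zy₂ zw y₁≢y₂ (≢-sym p) (≢-sym q))) ¬OnTriangle-z

    -- If both neighbours of z are deep, z has at most one conflict p – u on each side.
    Deep : V → Set
    Deep y = ∃[ p ] ∃[ r ] y ~ p × Small xs zs p × p ~ r × Small xs zs r × r ≢ y

    Deep? : ∀ y → Dec (Deep y)
    Deep? y = any? λ p → any? λ r → (y ~? p) ×-dec Small? xs zs p ×-dec (p ~? r) ×-dec Small? xs zs r ×-dec ¬? (r ≟ y)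

    -- The Kempe component of y₁ is y₁ with its neighbours; exchanging its colours frees a colour for z.
    insert-shallow : ∀ {y₁ y₂} → z ~ y₁ → z ~ y₂ → Small xs zs y₁ → Small xs zs y₂ → κ y₁ ≢ κ y₂ →
      ¬ Deep y₁ → State (z ∷ xs)
    insert-shallow {y₁} {y₂} zy₁ zy₂ s₁ s₂ κ≢ ¬deep =
      insert-small (flip-on K? κ)
        (λ su sv e → flip-preserves-≢ K? κ (closed sv e) (closed su (~-sym e)) (κ-proper su sv e))
        (κ y₁) differs
      where
      K : V → Set
      K u = u ≡ y₁ ⊎ (y₁ ~ u × Small xs zs u)
      K? : ∀ u → Dec (K u)
      K? u = (u ≟ y₁) ⊎-dec ((y₁ ~? u) ×-dec Small? xs zs u)
      closed : ∀ {u v} → Small xs zs v → u ~ v → K u → K v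
      closed sv e (inj₁ refl) = inj₂ (e , sv)
      closed {v = v} sv e (inj₂ (y₁u , su)) with v ≟ y₁
      ... | yes v≡y₁ = inj₁ v≡y₁
      ... | no v≢y₁ = contradiction (_ , v , y₁u , su , e , sv , v≢y₁) ¬deep
      y₂∉K : ¬ K y₂
      y₂∉K (inj₁ refl) = κ≢ refl
      y₂∉K (inj₂ (y₁y₂ , _)) = ¬OnTriangle-z (_ , _ , zy₁ , zy₂ , y₁y₂)
      differs : ∀ {w} → Small xs zs w → z ~ w → κ y₁ ≢ flip-on K? κ w
      differs _ zw with two-nbrs zy₁ zy₂ (λ { refl → κ≢ refl }) zw
      ... | inj₁ refl = λ eq → not-¬ {κ y₁} refl (trans eq (flip-∈ K? κ (inj₁ refl)))
      ... | inj₂ refl = λ eq → κ≢ (trans eq (flip-∉ K? κ y₂∉K))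

    -- `y` has degree 3 and so lies on a triangle; as `z` lies on none, its other vertices are `p`
    -- and `t`.
    spare-triangle : ∀ {y p t} → y ~ z → y ~ p → y ~ t → z ≢ p → z ≢ t → p ≢ t → p ~ t
    spare-triangle {y} {p} {t} yz yp yt z≢p z≢t p≢t with triangles (three⇒deg3 yz yp yt z≢p z≢t p≢t)
    ... | a , b , ya , yb , ab with third yz yp yt z≢p z≢t p≢t ya | third yz yp yt z≢p z≢t p≢t yb
    ... | inj₁ refl | _ = contradiction (y , b , ~-sym yz , ab , yb) ¬OnTriangle-z
    ... | _ | inj₁ refl = contradiction (y , a , ~-sym yz , ~-sym ab , ya) ¬OnTriangle-z
    ... | inj₂ (inj₁ refl) | inj₂ (inj₁ refl) = contradiction ab ~-irrefl
    ... | inj₂ (inj₁ refl) | inj₂ (inj₂ refl) = ab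
    ... | inj₂ (inj₂ refl) | inj₂ (inj₁ refl) = ~-sym ab
    ... | inj₂ (inj₂ refl) | inj₂ (inj₂ refl) = contradiction ab ~-irrefl

    module Deeply (z-nbrs : ∀ {w} → z ~ w → Small xs zs w) where

      small-≢-big : ∀ {u v} → Small xs zs u → Big zs v → u ≢ v
      small-≢-big (_ , ¬b) b refl = ¬b b

      big-≢z : ∀ {u} → Big zs u → z ≢ u
      big-≢z b = done-≢z (big⇒done b)

      -- If the path avoids `p`, its next vertex `s` forms a triangle with `y` and `p`. For `s`
      -- equal to `u` this is the claim; otherwise `s` is the pick of the triangle, and a pick has
      -- no neighbour in `Big`.
      side : ∀ {y p u} → z ~ y → y ~ p → Small xs zs p → Big zs u → Within 2 y u → p ~ u
      side zy yp sp bu (inj₁ refl) = contradiction refl (small-≢-big (z-nbrs zy) bu)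
      side {y} {p} {u} zy yp sp bu (inj₂ (s , ys , d)) with s ≟ p
      side zy yp sp bu (inj₂ (s , ys , inj₁ refl)) | yes refl = contradiction refl (small-≢-big sp bu)
      side zy yp sp bu (inj₂ (s , ys , inj₂ (_ , su , refl))) | yes refl = su
      side zy yp sp bu (inj₂ (s , ys , inj₁ refl)) | no s≢p =
        spare-triangle (~-sym zy) yp ys (done-≢z (proj₁ sp)) (big-≢z bu) (≢-sym s≢p)
      side {y} {p} {u} zy yp sp bu (inj₂ (s , ys , inj₂ (_ , su , refl))) | no s≢p with z ≟ s
      ... | yes refl = contradiction refl (small-≢-big (z-nbrs su) bu)
      ... | no z≢s = contradiction su (λ e → ¬xs-big bu e (xs-picked (Picked-hit yp ys ps)))
        where
        ps : p ~ s
        ps = spare-triangle (~-sym zy) yp ys (done-≢z (proj₁ sp)) z≢s (≢-sym s≢p)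
        xs-picked : Picked y ⊎ Picked p ⊎ Picked s → Picked s
        xs-picked (inj₁ xy) = contradiction (inj₁ xy) (proj₂ (z-nbrs zy))
        xs-picked (inj₂ (inj₁ xp)) = contradiction (inj₁ xp) (proj₂ sp)
        xs-picked (inj₂ (inj₂ x)) = x
        ¬xs-big : Big zs u → s ~ u → ¬ Picked s
        ¬xs-big (inj₁ xu) e x = Picked-independent x xu e
        ¬xs-big (inj₂ u∈) e x = proj₂ (proj₂ (proj₂ (zs-free u∈)) (~-sym e)) (inj₁ x)

      -- `p` already has the neighbours `y` and `r` outside `Big`; by `side` every conflict on this
      -- side is its third neighbour.
      side-unique : ∀ {y u v} → z ~ y → Deep y → Big zs u → Big zs v → Within 2 y u → Within 2 y v → u ≡ v
      side-unique zy (p , r , yp , sp , pr , sr , r≢y) bu bv du dv =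
        third-unique (~-sym yp) pr (≢-sym r≢y)
          (side zy yp sp bu du) (≢-sym (small-≢-big (z-nbrs zy) bu)) (≢-sym (small-≢-big sr bu))
          (side zy yp sp bv dv) (≢-sym (small-≢-big (z-nbrs zy) bv)) (≢-sym (small-≢-big sr bv))

    -- Each of the two sides contributes at most one vertex of `Big` within distance 3 of `z`, so
    -- one of three colours is free.
    insert-deep : ∀ {y₁ y₂} → z ~ y₁ → z ~ y₂ → Small xs zs y₁ → Small xs zs y₂ → y₁ ≢ y₂ →
      Deep y₁ → Deep y₂ → State (z ∷ xs)
    insert-deep {y₁} {y₂} zy₁ zy₂ s₁ s₂ y₁≢y₂ deep₁ deep₂ = record
      { zs = z ∷ zs ; κ = κ ; c = update z (proj₁ free) c
      ; zs-free = λ { (here refl) → ¬OnTriangle-z , here refl , λ e → grow (z-nbrs e)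
                    ; (there u∈) → let (¬t , u∈xs , nbrs) = zs-free u∈ in ¬t , there u∈xs , λ e → grow (nbrs e) }
      ; κ-proper = λ su sv → κ-proper (shrink su) (shrink sv)
      ; c-proper = proper }
      where
      z-nbrs : ∀ {w} → z ~ w → Small xs zs w
      z-nbrs zw with two-nbrs zy₁ zy₂ y₁≢y₂ zw
      ... | inj₁ refl = s₁
      ... | inj₂ refl = s₂
      open Deeply z-nbrs
      grow : ∀ {w} → Small xs zs w → Small (z ∷ xs) (z ∷ zs) w
      grow (d , ¬b) = weaken d , λ { (inj₁ x) → ¬b (inj₁ x)
                                   ; (inj₂ (here refl)) → z∉ d
                                   ; (inj₂ (there w∈)) → ¬b (inj₂ w∈) }
      shrink : ∀ {w} → Small (z ∷ xs) (z ∷ zs) w → Small xs zs w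
      shrink (d , ¬b) = strengthen (λ { refl → ¬b (inj₂ (here refl)) }) d
                      , λ { (inj₁ x) → ¬b (inj₁ x) ; (inj₂ w∈) → ¬b (inj₂ (there w∈)) }
      Near : V → Set
      Near u = Big zs u × Within 3 z u
      side-of : ∀ {u} → Near u → Within 2 y₁ u ⊎ Within 2 y₂ u
      side-of (bu , inj₁ z≡u) = contradiction z≡u (big-≢z bu)
      side-of (bu , inj₂ (s , zs , d)) with two-nbrs zy₁ zy₂ y₁≢y₂ zs
      ... | inj₁ refl = inj₁ d
      ... | inj₂ refl = inj₂ d
      ≤2 : AtMostTwo Near
      ≤2 p q r p≢q p≢r q≢r with side-of p | side-of q | side-of r
      ... | inj₁ a | inj₁ b | _ = p≢q (side-unique zy₁ deep₁ (proj₁ p) (proj₁ q) a b)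
      ... | inj₁ a | inj₂ _ | inj₁ b = p≢r (side-unique zy₁ deep₁ (proj₁ p) (proj₁ r) a b)
      ... | inj₁ _ | inj₂ a | inj₂ b = q≢r (side-unique zy₂ deep₂ (proj₁ q) (proj₁ r) a b)
      ... | inj₂ a | inj₂ b | _ = p≢q (side-unique zy₂ deep₂ (proj₁ p) (proj₁ q) a b)
      ... | inj₂ a | inj₁ _ | inj₂ b = p≢r (side-unique zy₂ deep₂ (proj₁ p) (proj₁ r) a b)
      ... | inj₂ _ | inj₁ a | inj₁ b = q≢r (side-unique zy₁ deep₁ (proj₁ q) (proj₁ r) a b)
      free = free-colour (λ u → Big? zs u ×-dec Within? 3 z u) ≤2 c
      old : ∀ {u} → z ≢ u → Big (z ∷ zs) u → Big zs u
      old _ (inj₁ x) = inj₁ x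
      old z≢u (inj₂ (here refl)) = contradiction refl z≢u
      old _ (inj₂ (there u∈)) = inj₂ u∈
      proper : ∀ {u v} → Big (z ∷ zs) u → Big (z ∷ zs) v → u ≢ v → Within 3 u v →
        update z (proj₁ free) c u ≢ update z (proj₁ free) c v
      proper {u} {v} bu bv u≢v d with z ≟ u | z ≟ v
      ... | yes refl | yes refl = contradiction refl u≢v
      ... | yes refl | no z≢v = ≢-sym (proj₂ free (old z≢v bv , d))
      ... | no z≢u | yes refl = proj₂ free (old z≢u bu , Within-sym 3 d)
      ... | no z≢u | no z≢v = c-proper (old z≢u bu) (old z≢v bv) u≢v d

    insert : State (z ∷ xs)
    insert with any? (λ y → (z ~? y) ×-dec Small? xs zs y ×-dec (κ y Bool.≟ true))
              | any? (λ y → (z ~? y) ×-dec Small? xs zs y ×-dec (κ y Bool.≟ false))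
    ... | no ¬true | _ = insert-small κ κ-proper true λ sw zw eq → ¬true (_ , zw , sw , sym eq)
    ... | _ | no ¬false = insert-small κ κ-proper false λ sw zw eq → ¬false (_ , zw , sw , sym eq)
    ... | yes (y₁ , zy₁ , s₁ , κ₁) | yes (y₂ , zy₂ , s₂ , κ₂) = go (Deep? y₁) (Deep? y₂)
      where
      κ≢ : κ y₁ ≢ κ y₂
      κ≢ eq with () ← trans (sym κ₁) (trans eq κ₂)
      go : Dec (Deep y₁) → Dec (Deep y₂) → State (z ∷ xs)
      go (no ¬deep) _ = insert-shallow zy₁ zy₂ s₁ s₂ κ≢ ¬deep
      go _ (no ¬deep) = insert-shallow zy₂ zy₁ s₂ s₁ (≢-sym κ≢) ¬deep
      go (yes deep₁) (yes deep₂) = insert-deep zy₁ zy₂ s₁ s₂ (λ { refl → κ≢ refl }) deep₁ deep₂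

  skip : ∀ {z xs} → Done xs z → State xs → State (z ∷ xs)
  skip {z} {xs} dz state = record
    { zs = zs ; κ = κ ; c = c
    ; zs-free = λ u∈ → let (¬t , u∈xs , nbrs) = zs-free u∈
                       in ¬t , there u∈xs , λ e → weaken (proj₁ (nbrs e)) , proj₂ (nbrs e)
    ; κ-proper = λ (du , bu) (dv , bv) → κ-proper (strengthen du , bu) (strengthen dv , bv)
    ; c-proper = c-proper }
    where
    open State state
    weaken : ∀ {u} → Done xs u → Done (z ∷ xs) u
    weaken (inj₁ t) = inj₁ t
    weaken (inj₂ u∈) = inj₂ (there u∈)
    strengthen : ∀ {u} → Done (z ∷ xs) u → Done xs u
    strengthen (inj₁ t) = inj₁ t
    strengthen (inj₂ (here refl)) = dz
    strengthen (inj₂ (there u∈)) = inj₂ u∈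

  run : ∀ xs → State xs
  run [] = initial
  run (z ∷ xs) with Done? xs z
  ... | yes dz = skip dz (run xs)
  ... | no z∉ = Insert.insert (run xs) z∉

  -- The packing colouring

  packing : PackingColorable G (1 ∷ 1 ∷ 3 ∷ 3 ∷ 3 ∷ [])
  packing = colour , λ u v u≢v eq m m≤s walk → separated u v u≢v eq m≤s walk
    where
    -- All vertices have been processed, so every vertex outside `Big` is `Small`.
    open State (run (allFin n))
    colour : V → Fin 5
    colour u with Big? zs u | κ u
    ... | yes _ | _ = suc (suc (c u))
    ... | no _ | true = 0F
    ... | no _ | false = 1F

    radius : Fin 5 → ℕ
    radius = Vec.lookup (1 ∷ 1 ∷ 3 ∷ 3 ∷ 3 ∷ [])

    radius≡3 : ∀ i → radius (suc (suc i)) ≡ 3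
    radius≡3 0F = refl
    radius≡3 1F = refl
    radius≡3 2F = refl

    small-separated : ∀ {u v m} → ¬ Big zs u → ¬ Big zs v → u ≢ v → κ u ≡ κ v → m ℕ.≤ 1 → ¬ Walk G u v m
    small-separated {u} {v} ¬bu ¬bv u≢v eq m≤1 walk with walk⇒Within 1 m≤1 walk
    ... | inj₁ u≡v = u≢v u≡v
    ... | inj₂ (_ , e , refl) = κ-proper (inj₂ (∈-allFin u) , ¬bu) (inj₂ (∈-allFin v) , ¬bv) e eq

    separated : ∀ u v {m} → u ≢ v → colour u ≡ colour v → m ℕ.≤ radius (colour u) → ¬ Walk G u v m
    separated u v u≢v eq m≤ walk with Big? zs u | κ u in ku | Big? zs v | κ v in kv
    ... | yes bu | _ | yes bv | _ =
      c-proper bu bv u≢v (walk⇒Within 3 (ℕ.≤-trans m≤ (ℕ.≤-reflexive (radius≡3 (c u)))) walk)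
      (Fin.suc-injective (Fin.suc-injective eq))
    ... | no ¬bu | true | no ¬bv | true = small-separated ¬bu ¬bv u≢v (trans ku (sym kv)) m≤ walk
    ... | no ¬bu | false | no ¬bv | false = small-separated ¬bu ¬bv u≢v (trans ku (sym kv)) m≤ walk
    separated u v u≢v () m≤ walk | no _ | true | no _ | false
    separated u v u≢v () m≤ walk | no _ | false | no _ | true
    separated u v u≢v () m≤ walk | yes _ | _ | no _ | true
    separated u v u≢v () m≤ walk | yes _ | _ | no _ | false
    separated u v u≢v () m≤ walk | no _ | true | yes _ | _
    separated u v u≢v () m≤ walk | no _ | false | yes _ | _

theorem7 : (G : Graph) → Subcubic G → Saturated3 G 2 → G3Is G 3 →
    PackingColorable G (1 ∷ 1 ∷ 3 ∷ 3 ∷ 3 ∷ [])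
theorem7 G subcubic saturated (_ , g₃≤3) = Insertion.packing G subcubic saturated triangles
  where
  -- Cycles have length at least 3, so a local girth of at most 3 comes from a triangle through `v`.
  triangles : ∀ {v} → degree G v ≡ 3 → Neighbourhoods.OnTriangle G v
  triangles {v} d = from-cycle (g₃≤3 v d)
    where
    from-cycle : ∃ (λ m → m ℕ.≤ 3 × LocalGirthIs G v m) → Neighbourhoods.OnTriangle G v
    from-cycle (3 , _ , (_ , f , _ , refl , path , close) , _) =
      f 1F , f 2F , path 0F , Neighbourhoods.~-sym G close , path 1F
    from-cycle (1 , _ , (() , _) , _)
    from-cycle (2 , _ , (ℕ.s≤s () , _) , _)
    from-cycle (ℕ.suc (ℕ.suc (ℕ.suc (ℕ.suc _))) , ℕ.s≤s (ℕ.s≤s (ℕ.s≤s ())) , _)
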